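{- $\mathrm{FO}(\mathrm H)\le\mathrm{ESO}_{\mathbb R}(+,\times,\log)$ and $\mathrm{FO}(\mathrm H,\sim)\le\mathrm{SO}_{\mathbb R}(+,\times,\log)$; that is, for every $\mathrm{FO}(\mathrm H)$-formula (resp. $\mathrm{FO}(\mathrm H,\sim)$-formula) $\phi$ with free variables among $\bar v=(v_1,\dots,v_k)$ there is an $\mathrm{ESO}_{\mathbb R}(+,\times,\log)$-formula (resp. $\mathrm{SO}_{\mathbb R}(+,\times,\log)$-formula) $\psi_\phi(f)$ with a single free $k$-ary function variable $f$ such that for all finite structures $\mathcal A$ and probabilistic teams $\mathbb X$ over $\{v_1,\dots,v_k\}$: $\mathcal A\models_{\mathbb X}\phi$ iff $(\mathcal A,f_{\mathbb X})\models\psi_\phi(f)$.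
   Context: Probabilistic team semantics. Structures $\mathcal A$ are finite with universe $A$. An assignment over a finite set $D$ of variables is $s\colon D\to A$; $s(a/x)$ maps $x$ to $a$ and agrees with $s$ elsewhere. A probabilistic team over $D$ is $\mathbb X\colon X\to[0,1]$ with $\sum_{s\in X}\mathbb X(s)=1$, $X$ a finite set of assignments over $D$; $\mathrm{supp}(\mathbb X)=\{s:\mathbb X(s)\ne0\}$; $|\mathbb X_{\bar x=\bar a}|=\sum_{s(\bar x)=\bar a}\mathbb X(s)$. $\mathbb X(F/x)(s(a/x))=\sum_{t\in X,\ t(a/x)=s(a/x)}\mathbb X(t)F(t)(a)$ for $F$ assigning to each $t\in X$ a distribution on $A$; $\mathbb X(A/x)$ uses uniform $F(t)$; $\mathbb Y\sqcup_k\mathbb Z$ is $s\mapsto k\mathbb Y(s)+(1-k)\mathbb Z(s)$. Semantics: first-order literals hold in $\mathbb X$ iff every $s\in\mathrm{supp}(\mathbb X)$ satisfies them; $\wedge$ classical; $\phi\vee\psi$ holds in $\mathbb X$ iff $\phi$ holds in $\mathbb Y$ and $\psi$ in $\mathbb Z$ for some $\mathbb Y,\mathbb Z,k$ with $\mathbb Y\sqcup_k\mathbb Z=\mathbb X$; $\exists x\phi$ holds iff $\phi$ holds in some $\mathbb X(F/x)$; $\forall x\phi$ holds iff $\phi$ holds in $\mathbb X(A/x)$; $\sim\phi$ holds iff $\phi$ does not. $\mathrm{FO}(\mathrm H)$ is first-order logic with these semantics extended by entropy atoms $\mathrm H(\bar x)=\mathrm H(\bar y)$, holding iff $\mathrm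 H_{\mathbb X}(\bar x)=\mathrm H_{\mathbb X}(\bar y)$, where $\mathrm H_{\mathbb X}(\bar x)=-\sum_{\bar a}P(\bar a)\log_2P(\bar a)$, $P(\bar a)=|\mathbb X_{\bar x=\bar a}|$, $0\log0=0$; $\mathrm{FO}(\mathrm H,\sim)$ additionally allows $\sim$. $\mathrm{SO}_{\mathbb R}(+,\times,\log)$: over $\mathbb R$-structures (finite structures expanded by functions $A^{\mathrm{Ar}(f)}\to\mathbb R$), numerical terms built from $f(\bar x)$ using $+,\times,\log$; formulas $i=j\mid\neg i=j\mid R(\bar x)\mid\neg R(\bar x)\mid\wedge\mid\vee\mid\exists x\mid\forall x\mid\exists f\mid\forall f$, function quantifiers ranging over all functions into $\mathbb R$; $\mathrm{ESO}_{\mathbb R}$ forbids $\forall f$. For a team $\mathbb X$ over $\{v_1,\dots,v_k\}$, $f_{\mathbb X}\colon A^k\to[0,1]$ is given by $f_{\mathbb X}(s(\bar v))=\mathbb X(s)$ (and $0$ on tuples not arising from $X$).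
   Formalization: First-order equality literals x=y and ¬x=y are added to SO_R and ESO_R; without them the ESO part fails, since equality-free ESO_R truth survives duplicating elements while ∀x∀y x=y (k=0) separates |A|=1 from |A|=2. -}

module Defs where

open import Algebra.Bundles using (CommutativeRing)
import Algebra.Properties.Semiring.Sum as SemiringSum
open import Data.Bool.Base using (if_then_else_)
open import Data.Empty using (⊥)
open import Data.Fin.Base using (Fin)
import Data.Fin.Properties as Fin
open import Data.List.Base using (List; []; _∷_; length)
open import Data.List.Membership.DecPropositional using (_∈?_)
open import Data.List.Membership.Propositional using (_∈_)
open import Data.List.Relation.Unary.All as All using (All; []; _∷_)
open import Data.List.Relation.Unary.Any using (here; index)
open import Data.Nat.Base using (ℕ; zero; suc)
import Data.Nat.Properties as ℕ
open import Data.Product.Base using (∃; ∃-syntax; _×_; _,_; proj₂)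
open import Data.Sum.Base using (_⊎_)
open import Data.Unit.Base using (⊤)
open import Data.Vec.Base as Vec using (Vec; []; _∷_; _[_]≔_)
import Data.Vec.Properties as Vec
open import Function.Base using (const)
open import Function.Bundles using (_↔_; module Inverse)
open import Function.Properties.Inverse using (↔-sym; ↔⇒↣)
open import Level using (0ℓ)
open import Relation.Binary.Core using (Rel)
open import Relation.Binary.Definitions using (DecidableEquality)
open import Relation.Binary.PropositionalEquality.Core using (_≡_; refl)
open import Relation.Binary.Structures using (IsTotalOrder)
open import Relation.Nullary using (¬_; yes; no; does)
open import Relation.Unary using (Pred)

-- The real numbers, as a Dedekind-complete totally ordered field; classically
-- this determines them up to isomorphism.  The laws of log₂ determine it on
-- the positive reals.  Its values at other arguments are left arbitrary, and
-- likewise that of 0# ⁻¹.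
record RealNumbers : Set₁ where
  field
    commutativeRing : CommutativeRing 0ℓ 0ℓ

  open CommutativeRing commutativeRing public renaming (Carrier to ℝ)

  infix  4 _≤_ _<_
  infix  8 _⁻¹

  field
    _≤_          : Rel ℝ 0ℓ
    isTotalOrder : IsTotalOrder _≈_ _≤_
    0≉1          : ¬ 0# ≈ 1#
    _⁻¹          : ℝ → ℝ
    *-inverseʳ   : ∀ {x} → ¬ x ≈ 0# → x * x ⁻¹ ≈ 1#
    +-monoʳ-≤    : ∀ x {y z} → y ≤ z → x + y ≤ x + z
    *-nonNeg     : ∀ {x y} → 0# ≤ x → 0# ≤ y → 0# ≤ x * y

  _<_ : Rel ℝ 0ℓ
  x < y = x ≤ y × ¬ x ≈ y

  _isUpperBoundOf_ : ℝ → Pred ℝ 0ℓ → Set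
  b isUpperBoundOf P = ∀ x → P x → x ≤ b

  field
    supremum : (P : Pred ℝ 0ℓ) → ∃ P → (∃[ b ] b isUpperBoundOf P) →
               ∃[ c ] c isUpperBoundOf P × (∀ b → b isUpperBoundOf P → c ≤ b)
    log₂      : ℝ → ℝ
    log₂-cong : ∀ {x y} → x ≈ y → log₂ x ≈ log₂ y
    log₂-mono : ∀ {x y} → 0# < x → x ≤ y → log₂ x ≤ log₂ y
    log₂-*    : ∀ {x y} → 0# < x → 0# < y → log₂ (x * y) ≈ log₂ x + log₂ y
    log₂-2    : log₂ (1# + 1#) ≈ 1#

record Vocabulary : Set₁ where
  field
    Symbol : Set
    arity  : Symbol → ℕ

open Vocabulary public

record Structure (τ : Vocabulary) : Set₁ where
  field
    Universe : Set
    size-1   : ℕ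
    finite   : Fin (suc size-1) ↔ Universe
    ⟦_⟧      : (R : Symbol τ) → Vec Universe (arity τ R) → Set

  size : ℕ
  size = suc size-1

  infix 4 _≟_ _≟ᵛ_

  _≟_ : DecidableEquality Universe
  _≟_ = Fin.inj⇒≟ (↔⇒↣ (↔-sym finite))

  _≟ᵛ_ : ∀ {n} → DecidableEquality (Vec Universe n)
  _≟ᵛ_ = Vec.≡-dec _≟_

------------------------------------------------------------------------
-- Syntax of FO(H,∼)

Variable : Set
Variable = ℕ

-- A finite set of variables is listed without repetition.
Domain : Set
Domain = List Variable

-- D ⊕ x is D ∪ {x}.
_⊕_ : Domain → Variable → Domain
D ⊕ x with _∈?_ ℕ._≟_ x D
... | yes _ = D
... | no  _ = x ∷ D

∈-⊕ : ∀ D x → x ∈ D ⊕ x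
∈-⊕ D x with _∈?_ ℕ._≟_ x D
... | yes x∈D = x∈D
... | no  _   = here refl

VarOf : Domain → Set
VarOf D = ∃[ x ] x ∈ D

infixr 7 _∧_
infixr 6 _∨_
infix  4 _≐_ _≠_

-- Formulas whose free variables are among D.  Variables are named, so a
-- quantifier may rebind a variable that is already in D.
data Formula (τ : Vocabulary) (D : Domain) : Set where
  _≐_ _≠_ : VarOf D → VarOf D → Formula τ D
  rel ¬rel : (R : Symbol τ) → Vec (VarOf D) (arity τ R) → Formula τ D
  H[_]≐H[_] : ∀ {m n} → Vec (VarOf D) m → Vec (VarOf D) n → Formula τ D
  _∧_ _∨_ : Formula τ D → Formula τ D → Formula τ D
  ∃′ ∀′ : (x : Variable) → Formula τ (D ⊕ x) → Formula τ D
  ∼_ : Formula τ D → Formula τ D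

-- FO(H) is the fragment of FO(H,∼) without ∼.
IsFO[H] : ∀ {τ D} → Formula τ D → Set
IsFO[H] (x ≐ y)         = ⊤
IsFO[H] (x ≠ y)         = ⊤
IsFO[H] (rel R xs)      = ⊤
IsFO[H] (¬rel R xs)     = ⊤
IsFO[H] H[ xs ]≐H[ ys ] = ⊤
IsFO[H] (φ ∧ ψ)         = IsFO[H] φ × IsFO[H] ψ
IsFO[H] (φ ∨ ψ)         = IsFO[H] φ × IsFO[H] ψ
IsFO[H] (∃′ x φ)        = IsFO[H] φ
IsFO[H] (∀′ x φ)        = IsFO[H] φ
IsFO[H] (∼ φ)           = ⊥

------------------------------------------------------------------------
-- Syntax of SO_ℝ(+,×,log)

-- Γ lists the arities of the function variables in scope, and n is the
-- number of first-order variables in scope; both are de Bruijn-indexed.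
data Term (Γ : List ℕ) (n : ℕ) : Set where
  app     : ∀ {k} → k ∈ Γ → Vec (Fin n) k → Term Γ n
  _⊞_ _⊠_ : Term Γ n → Term Γ n → Term Γ n
  log     : Term Γ n → Term Γ n

data SO (τ : Vocabulary) (Γ : List ℕ) (n : ℕ) : Set where
  _≐ᶠ_ _≠ᶠ_ : Fin n → Fin n → SO τ Γ n
  _≐ⁿ_ _≠ⁿ_ : Term Γ n → Term Γ n → SO τ Γ n
  rel ¬rel  : (R : Symbol τ) → Vec (Fin n) (arity τ R) → SO τ Γ n
  _∧_ _∨_   : SO τ Γ n → SO τ Γ n → SO τ Γ n
  ∃¹ ∀¹     : SO τ Γ (suc n) → SO τ Γ n
  ∃² ∀²     : (k : ℕ) → SO τ (k ∷ Γ) n → SO τ Γ n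

-- ESO_ℝ(+,×,log) is the fragment without universal function quantifiers.
IsESO : ∀ {τ Γ n} → SO τ Γ n → Set
IsESO (x ≐ᶠ y)    = ⊤
IsESO (x ≠ᶠ y)    = ⊤
IsESO (i ≐ⁿ j)    = ⊤
IsESO (i ≠ⁿ j)    = ⊤
IsESO (rel R xs)  = ⊤
IsESO (¬rel R xs) = ⊤
IsESO (φ ∧ ψ)     = IsESO φ × IsESO ψ
IsESO (φ ∨ ψ)     = IsESO φ × IsESO ψ
IsESO (∃¹ φ)      = IsESO φ
IsESO (∀¹ φ)      = IsESO φ
IsESO (∃² k φ)    = IsESO φ
IsESO (∀² k φ)    = ⊥

------------------------------------------------------------------------

module Semantics (R : RealNumbers) where

  open RealNumbers R
  open SemiringSum semiring using (sum)

  module Teams {τ : Vocabulary} (𝒜 : Structure τ) where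

    open Structure 𝒜

    ∑ : (Universe → ℝ) → ℝ
    ∑ g = sum {size} (λ i → g (Inverse.to finite i))

    ∑ᵛ : ∀ {n} → (Vec Universe n → ℝ) → ℝ
    ∑ᵛ {zero}  g = g []
    ∑ᵛ {suc n} g = ∑ λ a → ∑ᵛ λ as → g (a ∷ as)

    infix 9 _⟨_⟩ _⟨_⟩ᵛ
    infix 5 _⊢_[_/_] _⊢_[_//_]

    -- An assignment lists the values of the variables in the order of D.
    Assignment : Domain → Set
    Assignment D = Vec Universe (length D)

    -- s ⟨ x ⟩ is s(x).
    _⟨_⟩ : ∀ {D} → Assignment D → VarOf D → Universe
    s ⟨ x ⟩ = Vec.lookup s (index (proj₂ x))

    _⟨_⟩ᵛ : ∀ {D m} → Assignment D → Vec (VarOf D) m → Vec Universe m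
    s ⟨ xs ⟩ᵛ = Vec.map (s ⟨_⟩) xs

    -- D ⊢ s [ a / x ] is s(a/x), for s an assignment over D.
    _⊢_[_/_] : ∀ D → Assignment D → Universe → (x : Variable) → Assignment (D ⊕ x)
    D ⊢ s [ a / x ] with _∈?_ ℕ._≟_ x D
    ... | yes x∈D = s [ index x∈D ]≔ a
    ... | no  _   = a ∷ s

    -- A function 𝕏 : X → [0,1] is identified with its extension by 0 to the
    -- finite set of all assignments over D.
    Weighting : Domain → Set
    Weighting D = Assignment D → ℝ

    record IsTeam D (𝕏 : Weighting D) : Set where
      field
        nonNegative : ∀ s → 0# ≤ 𝕏 s
        atMostOne   : ∀ s → 𝕏 s ≤ 1#
        total       : ∑ᵛ 𝕏 ≈ 1#

    record IsDistribution (p : Universe → ℝ) : Set where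
      field
        nonNegative : ∀ a → 0# ≤ p a
        atMostOne   : ∀ a → p a ≤ 1#
        total       : ∑ p ≈ 1#

    supp : ∀ {n} → (Vec Universe n → ℝ) → Pred (Vec Universe n) 0ℓ
    supp 𝕏 s = ¬ 𝕏 s ≈ 0#

    -- ∣ 𝕏 ∣[ xs ≔ as ] is |𝕏_{x̄=ā}|.
    ∣_∣[_≔_] : ∀ {D m} → Weighting D → Vec (VarOf D) m → Vec Universe m → ℝ
    ∣ 𝕏 ∣[ xs ≔ as ] = ∑ᵛ λ s → if does (s ⟨ xs ⟩ᵛ ≟ᵛ as) then 𝕏 s else 0#

    -- 0 log 0 = 0 holds because log₂ is total and 0# is absorbing.
    entropy : ∀ {D m} → Weighting D → Vec (VarOf D) m → ℝ
    entropy 𝕏 xs = - ∑ᵛ λ as → ∣ 𝕏 ∣[ xs ≔ as ] * log₂ ∣ 𝕏 ∣[ xs ≔ as ]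

    -- D ⊢ 𝕏 [ F // x ] is 𝕏(F/x), for 𝕏 a team over D.  An assignment s over
    -- D ∪ {x} is of the form s′(a/x) only for a = s(x).
    _⊢_[_//_] : ∀ D → Weighting D → (Assignment D → Universe → ℝ) →
                (x : Variable) → Weighting (D ⊕ x)
    (D ⊢ 𝕏 [ F // x ]) s =
      let a = s ⟨ x , ∈-⊕ D x ⟩ in
      ∑ᵛ λ t → if does ((D ⊢ t [ a / x ]) ≟ᵛ s) then 𝕏 t * F t a else 0#

    uniform : Universe → ℝ
    uniform _ = (∑ (const 1#)) ⁻¹

    _⊔[_]_ : ∀ {n} → (Vec Universe n → ℝ) → ℝ → (Vec Universe n → ℝ) →
             Vec Universe n → ℝ
    (𝕐 ⊔[ k ] ℤ) s = k * 𝕐 s + (1# - k) * ℤ s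

  open Teams public using (Weighting; IsTeam)

  module _ {τ : Vocabulary} (𝒜 : Structure τ) where

    open Structure 𝒜
    open Teams 𝒜 hiding (Weighting; IsTeam)

    sat : ∀ D → Weighting 𝒜 D → Formula τ D → Set
    sat D 𝕏 (x ≐ y)     = ∀ s → supp 𝕏 s → s ⟨ x ⟩ ≡ s ⟨ y ⟩
    sat D 𝕏 (x ≠ y)     = ∀ s → supp 𝕏 s → ¬ s ⟨ x ⟩ ≡ s ⟨ y ⟩
    sat D 𝕏 (rel P xs)  = ∀ s → supp 𝕏 s → ⟦ P ⟧ (s ⟨ xs ⟩ᵛ)
    sat D 𝕏 (¬rel P xs) = ∀ s → supp 𝕏 s → ¬ ⟦ P ⟧ (s ⟨ xs ⟩ᵛ)
    sat D 𝕏 H[ xs ]≐H[ ys ] = entropy 𝕏 xs ≈ entropy 𝕏 ys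
    sat D 𝕏 (φ ∧ ψ)     = sat D 𝕏 φ × sat D 𝕏 ψ
    sat D 𝕏 (φ ∨ ψ)     =
      ∃[ 𝕐 ] ∃[ ℤ ] ∃[ k ]
        IsTeam 𝒜 D 𝕐 × IsTeam 𝒜 D ℤ × 0# ≤ k × k ≤ 1# ×
        (∀ s → (𝕐 ⊔[ k ] ℤ) s ≈ 𝕏 s) ×
        sat D 𝕐 φ × sat D ℤ ψ
    sat D 𝕏 (∃′ x φ)    =
      ∃[ F ] (∀ t → IsDistribution (F t)) × sat (D ⊕ x) (D ⊢ 𝕏 [ F // x ]) φ
    sat D 𝕏 (∀′ x φ)    = sat (D ⊕ x) (D ⊢ 𝕏 [ const uniform // x ]) φ
    sat D 𝕏 (∼ φ)       = ¬ sat D 𝕏 φ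

  infix 3 _⊨[_]_

  _⊨[_]_ : ∀ {τ D} (𝒜 : Structure τ) → Weighting 𝒜 D → Formula τ D → Set
  𝒜 ⊨[ 𝕏 ] φ = sat 𝒜 _ 𝕏 φ

  module _ {τ : Vocabulary} (𝒜 : Structure τ) where

    open Structure 𝒜

    FunctionEnv : List ℕ → Set
    FunctionEnv Γ = All (λ k → Vec Universe k → ℝ) Γ

    eval : ∀ {Γ n} → FunctionEnv Γ → Vec Universe n → Term Γ n → ℝ
    eval ρ e (app f xs) = All.lookup ρ f (Vec.map (Vec.lookup e) xs)
    eval ρ e (i ⊞ j)    = eval ρ e i + eval ρ e j
    eval ρ e (i ⊠ j)    = eval ρ e i * eval ρ e j
    eval ρ e (log i)    = log₂ (eval ρ e i)

    satSO : ∀ {Γ n} → FunctionEnv Γ → Vec Universe n → SO τ Γ n → Set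
    satSO ρ e (x ≐ᶠ y)    = Vec.lookup e x ≡ Vec.lookup e y
    satSO ρ e (x ≠ᶠ y)    = ¬ Vec.lookup e x ≡ Vec.lookup e y
    satSO ρ e (i ≐ⁿ j)    = eval ρ e i ≈ eval ρ e j
    satSO ρ e (i ≠ⁿ j)    = ¬ eval ρ e i ≈ eval ρ e j
    satSO ρ e (rel P xs)  = ⟦ P ⟧ (Vec.map (Vec.lookup e) xs)
    satSO ρ e (¬rel P xs) = ¬ ⟦ P ⟧ (Vec.map (Vec.lookup e) xs)
    satSO ρ e (φ ∧ ψ)     = satSO ρ e φ × satSO ρ e ψ
    satSO ρ e (φ ∨ ψ)     = satSO ρ e φ ⊎ satSO ρ e ψ
    satSO ρ e (∃¹ φ)      = ∃[ a ] satSO ρ (a ∷ e) φ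
    satSO ρ e (∀¹ φ)      = ∀ a → satSO ρ (a ∷ e) φ
    satSO ρ e (∃² k φ)    = ∃[ f ] satSO (f ∷ ρ) e φ
    satSO ρ e (∀² k φ)    = ∀ f → satSO (f ∷ ρ) e φ

  infix 3 ⟨_,_⟩⊨_

  -- Satisfaction of ψ(f), with f its only free variable.
  ⟨_,_⟩⊨_ : ∀ {τ k} (𝒜 : Structure τ) →
            (Vec (Structure.Universe 𝒜) k → ℝ) → SO τ (k ∷ []) 0 → Set
  ⟨ 𝒜 , f ⟩⊨ ψ = satSO 𝒜 (f ∷ []) [] ψ

  -- The function f_𝕏: an assignment s over v̄ is by encoding the tuple s(v̄),
  -- and 𝕏 is already 0 on the tuples not arising from the team.
  functionOf : ∀ {τ} (𝒜 : Structure τ) (v̄ : Domain) → Weighting 𝒜 v̄ →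
               Vec (Structure.Universe 𝒜) (length v̄) → ℝ
  functionOf 𝒜 v̄ 𝕏 s = 𝕏 s

{-# OPTIONS --safe #-}
module Submission where

-- The translation reads a team as a function into ℝ and expresses the team
-- operations by existentially quantified functions.  Only finite sums are not
-- directly available: ∑ₐ t(a) is the last entry of the function c of partial
-- sums along an existentially quantified linear order of the universe, and
-- x ≤ y is expressed by ∃ z. x + z² = y.  Function quantifiers may occur below
-- first-order ones, so sums nest without auxiliary parameters.

-- The formula has to be fixed before the structure, so a sum cannot be unrolled into |A| summands,
-- and neither an order of the universe nor its size is known in advance; hence the quantified
-- order. Terms also lack constants, subtraction and comparison, and negation occurs only at atoms.
-- Every quantity is therefore described by its graph, a formula saying that a nullary function
-- holds its value. Two obligations result. Completeness needs one good choice of witnesses, such as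
-- the order of an enumeration. Soundness must cope with every choice: whatever order and partial
-- sums are picked, the same value has to come out, up to `≈`. One translation serves both claims:
-- membership in the existential fragment is a separate syntactic check, and only `∼`, translated by
-- the dual formula, turns function quantifiers into universal ones.

open import Defs
import Algebra.Properties.Ring
import Algebra.Properties.Semiring.Sum
import Algebra.Solver.Ring.NaturalCoefficients.Default
open import Axiom.ExcludedMiddle using (ExcludedMiddle)
open import Data.Bool.Base using (if_then_else_)
open import Data.Empty using (⊥-elim)
open import Data.Fin.Base as Fin using (Fin; zero; suc; inject₁; fromℕ; toℕ; punchIn; _↑ˡ_; _↑ʳ_)
import Data.Fin.Induction as Fin
open import Data.Fin.Patterns
import Data.Fin.Properties as Fin
open import Data.List.Base using (List; []; _∷_; length)
open import Data.List.Membership.DecPropositional using (_∈?_)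
open import Data.List.Membership.Propositional using (_∈_)
open import Data.List.Relation.Unary.All as All using ([]; _∷_)
open import Data.List.Relation.Unary.Any using (here; there; index)
open import Data.List.Relation.Unary.Unique.Propositional using (Unique)
open import Data.Nat.Base as ℕ using (ℕ; zero; suc)
import Data.Nat.Properties as ℕ
open import Data.Product.Base using (Σ-syntax; ∃-syntax; _×_; _,_; proj₁; proj₂)
open import Data.Product.Function.NonDependent.Propositional using (_×-⇔_)
open import Data.Sum.Base as Sum using (_⊎_; inj₁; inj₂; [_,_]′)
open import Data.Unit.Base using (tt)
open import Data.Vec.Base as Vec using (Vec; []; _∷_; _++_; _[_]≔_; allFin)
import Data.Vec.Properties as Vec
open import Function.Base using (_∘_; const; id; case_of_)
open import Function.Bundles using (_⇔_; mk⇔; module Equivalence; module Inverse)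
open import Function.Construct.Composition using (_⇔-∘_)
open import Function.Construct.Symmetry using (⇔-sym)
open import Induction.WellFounded using (WellFounded; Acc; acc)
open import Level using (0ℓ)
open import Relation.Binary.Bundles using (TotalOrder)
open import Relation.Binary.Core using (Rel)
open import Relation.Binary.PropositionalEquality as ≡ using (_≡_)
import Relation.Binary.Reasoning.PartialOrder
import Relation.Binary.Reasoning.Setoid
open import Relation.Binary.Structures using (IsTotalOrder)
open import Relation.Nullary using (¬_; Dec; yes; no; does)
open import Relation.Nullary.Decidable using (¬?; decidable-stable)
open Equivalence using (to; from)

-- Ordered fields

module OrderedField (em : ExcludedMiddle 0ℓ) (R : RealNumbers) where

  open RealNumbers R
  open IsTotalOrder isTotalOrder public
    using ()
    renaming ( total to ≤-total; refl to ≤-refl; reflexive to ≤-reflexive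
             ; trans to ≤-trans; antisym to ≤-antisym)
  open Algebra.Properties.Ring ring using (x+x≈x⇒x≈0; -‿distribˡ-*; -‿distribʳ-*; -‿involutive)
  open Algebra.Solver.Ring.NaturalCoefficients.Default commutativeSemiring

  totalOrder : TotalOrder 0ℓ 0ℓ 0ℓ
  totalOrder = record { isTotalOrder = isTotalOrder }

  open Relation.Binary.Reasoning.PartialOrder (TotalOrder.poset totalOrder)

  +-mono-≤ : ∀ {x y u v} → x ≤ y → u ≤ v → x + u ≤ y + v
  +-mono-≤ {x} {y} {u} {v} x≤y u≤v = begin
    x + u ≤⟨ +-monoʳ-≤ x u≤v ⟩
    x + v ≈⟨ +-comm x v ⟩
    v + x ≤⟨ +-monoʳ-≤ v x≤y ⟩
    v + y ≈⟨ +-comm v y ⟩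
    y + v ∎

  x≤x+y : ∀ {x y} → 0# ≤ y → x ≤ x + y
  x≤x+y {x} {y} 0≤y = begin
    x      ≈⟨ +-identityʳ x ⟨
    x + 0# ≤⟨ +-monoʳ-≤ x 0≤y ⟩
    x + y  ∎

  x+[y-x]≈y : ∀ x y → x + (y - x) ≈ y
  x+[y-x]≈y x y = begin-equality
    x + (y - x) ≈⟨ +-comm x (y - x) ⟩
    y - x + x   ≈⟨ +-assoc y (- x) x ⟩
    y + (- x + x) ≈⟨ +-congˡ (-‿inverseˡ x) ⟩
    y + 0#      ≈⟨ +-identityʳ y ⟩
    y           ∎

  x≤y⇒0≤y-x : ∀ {x y} → x ≤ y → 0# ≤ y - x
  x≤y⇒0≤y-x {x} {y} x≤y = begin
    0#      ≈⟨ -‿inverseˡ x ⟨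
    - x + x ≤⟨ +-monoʳ-≤ (- x) x≤y ⟩
    - x + y ≈⟨ +-comm (- x) y ⟩
    y - x   ∎

  +-cancelʳ-≤ : ∀ z {x y} → x + z ≤ y + z → x ≤ y
  +-cancelʳ-≤ z {x} {y} x+z≤y+z = begin
    x             ≈⟨ cancel x ⟨
    x + z + (- z) ≤⟨ +-mono-≤ x+z≤y+z ≤-refl ⟩
    y + z + (- z) ≈⟨ cancel y ⟩
    y             ∎
    where
    cancel : ∀ w → w + z + (- z) ≈ w
    cancel w = trans (+-assoc w z (- z)) (trans (+-congˡ (-‿inverseʳ z)) (+-identityʳ w))

  *-monoˡ-≤ : ∀ {x y z} → 0# ≤ z → x ≤ y → z * x ≤ z * y
  *-monoˡ-≤ {x} {y} {z} 0≤z x≤y = begin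
    z * x               ≤⟨ x≤x+y (*-nonNeg 0≤z (x≤y⇒0≤y-x x≤y)) ⟩
    z * x + z * (y - x) ≈⟨ distribˡ z x (y - x) ⟨
    z * (x + (y - x))   ≈⟨ *-congˡ (x+[y-x]≈y x y) ⟩
    z * y               ∎

  *-monoʳ-≤ : ∀ {x y z} → 0# ≤ z → x ≤ y → x * z ≤ y * z
  *-monoʳ-≤ {x} {y} {z} 0≤z x≤y = begin
    x * z ≈⟨ *-comm x z ⟩
    z * x ≤⟨ *-monoˡ-≤ 0≤z x≤y ⟩
    z * y ≈⟨ *-comm z y ⟩
    y * z ∎

  x≤0⇒0≤-x : ∀ {x} → x ≤ 0# → 0# ≤ - x
  x≤0⇒0≤-x {x} x≤0 = begin
    0#      ≤⟨ x≤y⇒0≤y-x x≤0 ⟩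
    0# - x  ≈⟨ +-identityˡ (- x) ⟩
    - x     ∎

  0≤x*x : ∀ x → 0# ≤ x * x
  0≤x*x x with ≤-total 0# x
  ... | inj₁ 0≤x = *-nonNeg 0≤x 0≤x
  ... | inj₂ x≤0 = begin
    0#            ≤⟨ *-nonNeg (x≤0⇒0≤-x x≤0) (x≤0⇒0≤-x x≤0) ⟩
    - x * - x     ≈⟨ -‿distribˡ-* x (- x) ⟨
    - (x * - x)   ≈⟨ -‿cong (-‿distribʳ-* x x) ⟨
    - (- (x * x)) ≈⟨ -‿involutive (x * x) ⟩
    x * x         ∎

  0≤1 : 0# ≤ 1#
  0≤1 = ≤-trans (0≤x*x 1#) (≤-reflexive (*-identityˡ 1#))

  x*y≈z⇒y≈x⁻¹*z : ∀ {x y z} → ¬ x ≈ 0# → x * y ≈ z → y ≈ x ⁻¹ * z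
  x*y≈z⇒y≈x⁻¹*z {x} {y} {z} x≉0 xy≈z = begin-equality
    y              ≈⟨ *-identityˡ y ⟨
    1# * y         ≈⟨ *-congʳ (trans (*-comm _ _) (*-inverseʳ x≉0)) ⟨
    x ⁻¹ * x * y   ≈⟨ *-assoc _ _ _ ⟩
    x ⁻¹ * (x * y) ≈⟨ *-congˡ xy≈z ⟩
    x ⁻¹ * z       ∎

  x*x≈0⇒x≈0 : ∀ {x} → x * x ≈ 0# → x ≈ 0#
  x*x≈0⇒x≈0 {x} xx≈0 with em {x ≈ 0#}
  ... | yes x≈0 = x≈0
  ... | no  x≉0 = trans (x*y≈z⇒y≈x⁻¹*z x≉0 xx≈0) (zeroʳ _)

  -- The idempotents of a field are 0 and 1, and x ≠ x + x excludes 0. This is how a formula can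
  -- name 1 without a constant.
  idempotent⇒≈1 : ∀ {x} → x * x ≈ x → ¬ x ≈ x + x → x ≈ 1#
  idempotent⇒≈1 {x} xx≈x x≉x+x = trans (x*y≈z⇒y≈x⁻¹*z x≉0 xx≈x) (trans (*-comm _ _) (*-inverseʳ x≉0))
    where
    x≉0 : ¬ x ≈ 0#
    x≉0 x≈0 = x≉x+x (trans (sym (+-identityˡ x)) (+-congʳ (sym x≈0)))

  x≈x+x⇒x≈0 : ∀ {x} → x ≈ x + x → x ≈ 0#
  x≈x+x⇒x≈0 x≈x+x = x+x≈x⇒x≈0 _ (sym x≈x+x)

  x≈0⇒x≈x+x : ∀ {x} → x ≈ 0# → x ≈ x + x
  x≈0⇒x≈x+x x≈0 = trans (sym (+-identityʳ _)) (+-congˡ (sym x≈0))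

  1≉1+1 : ¬ 1# ≈ 1# + 1#
  1≉1+1 1≈1+1 = 0≉1 (sym (x≈x+x⇒x≈0 1≈1+1))

  -- If y ≤ x, then d = x - y satisfies y² + 2yd + d² = x² ≤ y² with yd ≥ 0, so d² ≤ 0 and d = 0.
  square-cancel-≤ : ∀ {x y} → 0# ≤ y → x * x ≤ y * y → x ≤ y
  square-cancel-≤ {x} {y} 0≤y xx≤yy with ≤-total x y
  ... | inj₁ x≤y = x≤y
  ... | inj₂ y≤x = ≤-reflexive (begin-equality
    x      ≈⟨ x+[y-x]≈y y x ⟨
    y + d  ≈⟨ +-congˡ d≈0 ⟩
    y + 0# ≈⟨ +-identityʳ y ⟩
    y      ∎)
    where
    d = x - y
    0≤d : 0# ≤ d
    0≤d = x≤y⇒0≤y-x y≤x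
    dd≤0 : d * d ≤ 0#
    dd≤0 = +-cancelʳ-≤ (y * y) (begin
      d * d + y * y                     ≤⟨ x≤x+y (0≤z+z (*-nonNeg 0≤y 0≤d)) ⟩
      d * d + y * y + (y * d + y * d)   ≈⟨ solve 2 (λ d y → d :* d :+ y :* y :+ (y :* d :+ y :* d) :=
                                             (y :+ d) :* (y :+ d)) refl d y ⟩
      (y + d) * (y + d)                 ≈⟨ *-cong (x+[y-x]≈y y x) (x+[y-x]≈y y x) ⟩
      x * x                             ≤⟨ xx≤yy ⟩
      y * y                             ≈⟨ +-identityˡ (y * y) ⟨
      0# + y * y                        ∎)
      where
      0≤z+z : ∀ {z} → 0# ≤ z → 0# ≤ z + z
      0≤z+z 0≤z = ≤-trans 0≤z (x≤x+y 0≤z)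
    d≈0 : d ≈ 0#
    d≈0 = x*x≈0⇒x≈0 (≤-antisym dd≤0 (0≤x*x d))

  -- With c the supremum of {y | y² ≤ x}, M = 1 + x and q = c + M, the secant
  -- step d = (x + c M) / q satisfies (d² - x) q² = (c² - x) (M² - x).  So d²
  -- and c² lie on the same side of x, whereas d ≤ c iff x ≤ c².
  sqrt : ∀ {x} → 0# ≤ x → ∃[ y ] y * y ≈ x
  sqrt {x} 0≤x = c , ≤-antisym cc≤x x≤cc
    where
    P : ℝ → Set
    P y = y * y ≤ x
    M = 1# + x
    0≤M : 0# ≤ M
    0≤M = ≤-trans 0≤1 (x≤x+y 0≤x)
    -- `r` is M² - x. With it the identity for `d` becomes `secant`, free of subtraction and so
    -- within reach of the solver for commutative semirings.
    r = 1# + x + x * x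
    0≤r : 0# ≤ r
    0≤r = ≤-trans 0≤M (x≤x+y (0≤x*x x))
    x≤MM : x ≤ M * M
    x≤MM = begin
      x     ≤⟨ x≤x+y 0≤r ⟩
      x + r ≈⟨ solve 1 (λ x → x :+ (con 1 :+ x :+ x :* x) := (con 1 :+ x) :* (con 1 :+ x)) refl x ⟩
      M * M ∎
    P0 : P 0#
    P0 = ≤-trans (≤-reflexive (zeroˡ 0#)) 0≤x
    sup = supremum P (0# , P0) (M , λ y yy≤x → square-cancel-≤ 0≤M (≤-trans yy≤x x≤MM))
    c = proj₁ sup
    upper = proj₁ (proj₂ sup)
    least = proj₂ (proj₂ sup)
    0≤c : 0# ≤ c
    0≤c = upper 0# P0
    q = c + M
    1≤q : 1# ≤ q
    1≤q = begin
      1#            ≈⟨ +-identityˡ 1# ⟨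
      0# + 1#       ≤⟨ +-mono-≤ 0≤c (x≤x+y 0≤x) ⟩
      c + M         ∎
    0≤q : 0# ≤ q
    0≤q = ≤-trans 0≤1 1≤q
    q≉0 : ¬ q ≈ 0#
    q≉0 q≈0 = 0≉1 (≤-antisym 0≤1 (≤-trans 1≤q (≤-reflexive q≈0)))
    i = q ⁻¹
    qi≈1 : q * i ≈ 1#
    qi≈1 = *-inverseʳ q≉0
    0≤i : 0# ≤ i
    0≤i = begin
      0#          ≤⟨ *-nonNeg 0≤q (0≤x*x i) ⟩
      q * (i * i) ≈⟨ *-assoc q i i ⟨
      q * i * i   ≈⟨ *-congʳ qi≈1 ⟩
      1# * i      ≈⟨ *-identityˡ i ⟩
      i           ∎
    e = x + c * M
    0≤e : 0# ≤ e
    0≤e = ≤-trans 0≤x (x≤x+y (*-nonNeg 0≤c 0≤M))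
    d = e * i
    secant : e * e + x * r ≈ x * (q * q) + c * c * r
    secant = solve 2 (λ x c →
      (x :+ c :* (con 1 :+ x)) :* (x :+ c :* (con 1 :+ x)) :+ x :* (con 1 :+ x :+ x :* x) :=
      x :* ((c :+ (con 1 :+ x)) :* (c :+ (con 1 :+ x))) :+ c :* c :* (con 1 :+ x :+ x :* x)) refl x c
    unscale : x ≈ x * (q * q) * (i * i)
    unscale = begin-equality
      x                       ≈⟨ *-identityʳ x ⟨
      x * 1#                  ≈⟨ *-congˡ (*-identityˡ 1#) ⟨
      x * (1# * 1#)           ≈⟨ *-congˡ (*-cong qi≈1 qi≈1) ⟨
      x * ((q * i) * (q * i)) ≈⟨ solve 3 (λ x q i → x :* ((q :* i) :* (q :* i)) :=
                                   x :* (q :* q) :* (i :* i)) refl x q i ⟩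
      x * (q * q) * (i * i)   ∎
    dd≈ : d * d ≈ e * e * (i * i)
    dd≈ = solve 2 (λ e i → e :* i :* (e :* i) := e :* e :* (i :* i)) refl e i
    dq≈e : d * q ≈ e
    dq≈e = trans (*-assoc e i q) (trans (*-congˡ (trans (*-comm i q) qi≈1)) (*-identityʳ e))
    x≤cc : x ≤ c * c
    x≤cc with ≤-total x (c * c)
    ... | inj₁ x≤cc = x≤cc
    ... | inj₂ cc≤x = +-cancelʳ-≤ (c * M) (begin
      x + c * M     ≈⟨ dq≈e ⟨
      d * q         ≤⟨ *-monoʳ-≤ 0≤q (upper d dd≤x) ⟩
      c * q         ≈⟨ distribˡ c c M ⟩
      c * c + c * M ∎)
      where
      ee≤xqq : e * e ≤ x * (q * q)
      ee≤xqq = +-cancelʳ-≤ (x * r) (begin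
        e * e + x * r           ≈⟨ secant ⟩
        x * (q * q) + c * c * r ≤⟨ +-monoʳ-≤ _ (*-monoʳ-≤ 0≤r cc≤x) ⟩
        x * (q * q) + x * r     ∎)
      dd≤x : d * d ≤ x
      dd≤x = begin
        d * d                 ≈⟨ dd≈ ⟩
        e * e * (i * i)       ≤⟨ *-monoʳ-≤ (0≤x*x i) ee≤xqq ⟩
        x * (q * q) * (i * i) ≈⟨ unscale ⟨
        x                     ∎
    cc≤x : c * c ≤ x
    cc≤x = +-cancelʳ-≤ (c * M) (begin
      c * c + c * M ≈⟨ distribˡ c c M ⟨
      c * q         ≤⟨ *-monoʳ-≤ 0≤q (least d λ y yy≤x → square-cancel-≤ 0≤d (≤-trans yy≤x x≤dd)) ⟩
      d * q         ≈⟨ dq≈e ⟩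
      x + c * M     ∎)
      where
      0≤d : 0# ≤ d
      0≤d = *-nonNeg 0≤e 0≤i
      xqq≤ee : x * (q * q) ≤ e * e
      xqq≤ee = +-cancelʳ-≤ (x * r) (begin
        x * (q * q) + x * r     ≤⟨ +-monoʳ-≤ _ (*-monoʳ-≤ 0≤r x≤cc) ⟩
        x * (q * q) + c * c * r ≈⟨ secant ⟨
        e * e + x * r           ∎)
      x≤dd : x ≤ d * d
      x≤dd = begin
        x                     ≈⟨ unscale ⟩
        x * (q * q) * (i * i) ≤⟨ *-monoʳ-≤ (0≤x*x i) xqq≤ee ⟩
        e * e * (i * i)       ≈⟨ dd≈ ⟨
        d * d                 ∎

  x≤y⇒∃z[x+z*z≈y] : ∀ {x y} → x ≤ y → ∃[ z ] x + z * z ≈ y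
  x≤y⇒∃z[x+z*z≈y] {x} {y} x≤y =
    let z , zz≈y-x = sqrt (x≤y⇒0≤y-x x≤y) in z , trans (+-congˡ zz≈y-x) (x+[y-x]≈y x y)

  x+z*z≈y⇒x≤y : ∀ {x y z} → x + z * z ≈ y → x ≤ y
  x+z*z≈y⇒x≤y {z = z} eq = ≤-trans (x≤x+y (0≤x*x z)) (≤-reflexive eq)

-- Finite sums

module Sums (em : ExcludedMiddle 0ℓ) (R : RealNumbers) {τ : Vocabulary} (𝒜 : Structure τ) where

  open RealNumbers R
  open OrderedField em R
  open Structure 𝒜
  open Semantics R
  open Teams 𝒜
  open Algebra.Properties.Semiring.Sum semiring
  open Relation.Binary.Reasoning.Setoid setoid

  ∑-cong : ∀ {g h : Universe → ℝ} → (∀ a → g a ≈ h a) → ∑ g ≈ ∑ h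
  ∑-cong g≈h = sum-cong-≋ {n = size} λ i → g≈h (Inverse.to finite i)

  ∑ᵛ-cong : ∀ {n} {g h : Vec Universe n → ℝ} → (∀ as → g as ≈ h as) → ∑ᵛ g ≈ ∑ᵛ h
  ∑ᵛ-cong {zero}  g≈h = g≈h []
  ∑ᵛ-cong {suc n} g≈h = ∑-cong λ a → ∑ᵛ-cong λ as → g≈h (a ∷ as)

  ∑-∑ᵛ-comm : ∀ {n} (g : Universe → Vec Universe n → ℝ) →
              (∑ λ a → ∑ᵛ λ as → g a as) ≈ (∑ᵛ λ as → ∑ λ a → g a as)
  ∑-∑ᵛ-comm {zero}  g = refl
  ∑-∑ᵛ-comm {suc n} g = begin
    (∑ λ a → ∑ λ b → ∑ᵛ λ as → g a (b ∷ as))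
      ≈⟨ ∑-comm {size} {size} (λ i j → ∑ᵛ λ as → g (Inverse.to finite i) (Inverse.to finite j ∷ as)) ⟩
    (∑ λ b → ∑ λ a → ∑ᵛ λ as → g a (b ∷ as))
      ≈⟨ ∑-cong (λ b → ∑-∑ᵛ-comm λ a as → g a (b ∷ as)) ⟩
    (∑ λ b → ∑ᵛ λ as → ∑ λ a → g a (b ∷ as)) ∎

  -- A universe has `suc size-1` elements, so a summand 1 splits off from a nonnegative rest. This
  -- lets `*-inverseʳ` apply to the inverse in `uniform`.
  ∑1≉0 : ¬ ∑ (const 1#) ≈ 0#
  ∑1≉0 ∑1≈0 = 0≉1 (≤-antisym 0≤1 (≤-trans (x≤x+y (0≤sum size-1)) (≤-reflexive ∑1≈0)))
    where
    0≤sum : ∀ n → 0# ≤ sum {n} (const 1#)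
    0≤sum zero    = ≤-refl
    0≤sum (suc n) = ≤-trans 0≤1 (x≤x+y (0≤sum n))

  ∑-const : ∀ u → ∑ (const u) ≈ ∑ (const 1#) * u
  ∑-const u = begin
    ∑ (const u)         ≈⟨ ∑-cong (λ _ → sym (*-identityˡ u)) ⟩
    ∑ (const (1# * u))  ≈⟨ *-distribʳ-sum {size} u (const 1#) ⟨
    ∑ (const 1#) * u    ∎

  -- Multiplying by |A| replaces dividing by it: 1/|A| is pinned down through a sum, which a formula
  -- can express.
  ∑-const≈1⇔uniform : ∀ {u} a → ∑ (const u) ≈ 1# ⇔ u ≈ uniform a
  ∑-const≈1⇔uniform {u} a = mk⇔
    (λ ∑u≈1 → trans (x*y≈z⇒y≈x⁻¹*z ∑1≉0 (trans (sym (∑-const u)) ∑u≈1)) (*-identityʳ _))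
    (λ u≈u₀ → trans (∑-const u) (trans (*-congˡ u≈u₀) (*-inverseʳ ∑1≉0)))

  infix 8 _when_
  _when_ : ∀ {P : Set} → ℝ → Dec P → ℝ
  x when P? = if does P? then x else 0#

  when-true : ∀ {P : Set} {x} (P? : Dec P) → P → x when P? ≈ x
  when-true (yes _) _ = refl
  when-true (no ¬p) p = ⊥-elim (¬p p)

  when-false : ∀ {P : Set} {x} (P? : Dec P) → ¬ P → x when P? ≈ 0#
  when-false (yes p) ¬p = ⊥-elim (¬p p)
  when-false (no _)  _  = refl

  when-cong : ∀ {P Q : Set} {x y} (P? : Dec P) (Q? : Dec Q) → P ⇔ Q → x ≈ y → x when P? ≈ y when Q?
  when-cong (yes _) (yes _) _   x≈y = x≈y
  when-cong (yes p) (no ¬q) P⇔Q _   = ⊥-elim (¬q (to P⇔Q p))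
  when-cong (no ¬p) (yes q) P⇔Q _   = ⊥-elim (¬p (from P⇔Q q))
  when-cong (no _)  (no _)  _   _   = refl

  when-congˡ : ∀ {P : Set} {x y} (P? : Dec P) → x ≈ y → x when P? ≈ y when P?
  when-congˡ P? = when-cong P? P? (mk⇔ (λ p → p) (λ p → p))

  when-⊎ : ∀ {P Q S : Set} {x} (P? : Dec P) (Q? : Dec Q) (S? : Dec S) →
           S ⇔ (P ⊎ Q) → ¬ (P × Q) → x when S? ≈ x when P? + x when Q?
  when-⊎ (yes p) (yes q) _ _ ¬pq = ⊥-elim (¬pq (p , q))
  when-⊎ (yes p) (no _) S? S⇔ _ = trans (when-true S? (from S⇔ (inj₁ p))) (sym (+-identityʳ _))
  when-⊎ (no _) (yes q) S? S⇔ _ = trans (when-true S? (from S⇔ (inj₂ q))) (sym (+-identityˡ _))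
  when-⊎ (no ¬p) (no ¬q) S? S⇔ _ =
    trans (when-false S? ([ ¬p , ¬q ]′ ∘ to S⇔)) (sym (+-identityˡ _))

  elem : Fin size → Universe
  elem = Inverse.to finite

  rank : Universe → Fin size
  rank = Inverse.from finite

  elem-rank : ∀ a → elem (rank a) ≡ a
  elem-rank = Inverse.strictlyInverseˡ finite

  rank-elem : ∀ i → rank (elem i) ≡ i
  rank-elem = Inverse.strictlyInverseʳ finite

  ∑-when-≡ : ∀ (g : Universe → ℝ) a → (∑ λ x → g x when (x ≟ a)) ≈ g a
  ∑-when-≡ g a = begin
    (∑ λ x → g x when (x ≟ a))
      ≈⟨ sum-remove {i = rank a} (λ i → g (elem i) when (elem i ≟ a)) ⟩
    g (elem (rank a)) when (elem (rank a) ≟ a) + sum {size-1} (λ i → others i)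
      ≈⟨ +-cong (when-true (elem (rank a) ≟ a) (elem-rank a))
                (sum-cong-≋ {n = size-1} (λ i → when-false (elem (punchIn (rank a) i) ≟ a) (elem≢ i))) ⟩
    g (elem (rank a)) + sum {size-1} (const 0#)
      ≈⟨ +-cong (reflexive (≡.cong g (elem-rank a))) (sum-replicate-zero size-1) ⟩
    g a + 0#
      ≈⟨ +-identityʳ _ ⟩
    g a ∎
    where
    others : Fin size-1 → ℝ
    others i = g (elem (punchIn (rank a) i)) when (elem (punchIn (rank a) i) ≟ a)
    elem≢ : ∀ i → ¬ elem (punchIn (rank a) i) ≡ a
    elem≢ i eq = Fin.punchInᵢ≢i (rank a) i (≡.trans (≡.sym (rank-elem _)) (≡.cong rank eq))

  -- Partial sums along a strict order

  module PartialSums (_◁_ : Rel Universe 0ℓ) where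

    Minimal : Universe → Set
    Minimal a = ∀ b → ¬ b ◁ a

    -- The elements below `a` are those equal to or below `b`. The equivalence is spelled out as a
    -- disjunction of its two cases because formulas negate atoms only; in this form it is what the
    -- formula `step` unfolds to.
    IsPredecessor : Universe → Universe → Set
    IsPredecessor b a = ∀ x → (x ◁ a × (x ≡ b ⊎ x ◁ b)) ⊎ (¬ x ◁ a × ¬ x ≡ b × ¬ x ◁ b)

    Greatest : Universe → Set
    Greatest m = ∀ x → x ≡ m ⊎ x ◁ m

    IsStep : (Universe → ℝ) → Universe → ℝ → Set
    IsStep c a w = Minimal a × c a ≈ w ⊎ ∃[ b ] IsPredecessor b a × c a ≈ c b + w

    -- The relation will be an equation between reals, so `em` has to decide it.
    partialSum : (Universe → ℝ) → Universe → ℝ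
    partialSum g a = ∑ λ x → g x when em {x ≡ a ⊎ x ◁ a}

    partialSum-minimal : ∀ g {a} → Minimal a → partialSum g a ≈ g a
    partialSum-minimal g {a} min = trans
      (∑-cong {h = λ x → g x when (x ≟ a)} λ x →
        when-cong {x = g x} em (x ≟ a) (mk⇔ [ (λ eq → eq) , ⊥-elim ∘ min x ]′ inj₁) refl)
      (∑-when-≡ g a)

    -- The part of the order up to `a` is the part up to `b` together with `a`; irreflexivity makes
    -- the union disjoint.
    partialSum-predecessor : (∀ a → ¬ a ◁ a) → ∀ g {a b} → IsPredecessor b a →
                             partialSum g a ≈ partialSum g b + g a
    partialSum-predecessor irrefl g {a} {b} pred = begin
      partialSum g a
        ≈⟨ ∑-cong (λ x → when-⊎ {x = g x} em (x ≟ a) em (split x) (disjoint x)) ⟩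
      (∑ λ x → g x when em {x ≡ b ⊎ x ◁ b} + g x when (x ≟ a))
        ≈⟨ ∑-distrib-+ {size} (λ i → g (elem i) when em {elem i ≡ b ⊎ elem i ◁ b})
                              (λ i → g (elem i) when (elem i ≟ a)) ⟩
      partialSum g b + (∑ λ x → g x when (x ≟ a))
        ≈⟨ +-congˡ (∑-when-≡ g a) ⟩
      partialSum g b + g a ∎
      where
      below : ∀ x → x ◁ a ⇔ (x ≡ b ⊎ x ◁ b)
      below x = mk⇔
        (λ x◁a → [ proj₂ , (λ (¬x◁a , _) → ⊥-elim (¬x◁a x◁a)) ]′ (pred x))
        (λ x⊴b → [ proj₁ , (λ (_ , x≢b , ¬x◁b) → ⊥-elim ([ x≢b , ¬x◁b ]′ x⊴b)) ]′ (pred x))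
      split : ∀ x → (x ≡ a ⊎ x ◁ a) ⇔ ((x ≡ b ⊎ x ◁ b) ⊎ x ≡ a)
      split x = mk⇔ [ inj₂ , inj₁ ∘ to (below x) ]′ [ inj₂ ∘ from (below x) , inj₁ ]′
      disjoint : ∀ x → ¬ ((x ≡ b ⊎ x ◁ b) × x ≡ a)
      disjoint x (x⊴b , ≡.refl) = irrefl a (from (below a) x⊴b)

    partialSum-greatest : ∀ g {m} → Greatest m → partialSum g m ≈ ∑ g
    partialSum-greatest g great = ∑-cong {h = g} λ x → when-true em (great x)

    module _ (irrefl : ∀ a → ¬ a ◁ a) (◁-trans : ∀ {a b c} → a ◁ b → b ◁ c → a ◁ c) where

      ◁-wellFounded : WellFounded (λ i j → elem i ◁ elem j)
      ◁-wellFounded = Fin.spo-wellFounded record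
        { isEquivalence = ≡.isEquivalence
        ; irrefl        = λ { ≡.refl → irrefl _ }
        ; trans         = ◁-trans
        ; <-resp-≈      = ≡.resp₂ _
        }

      -- Well-founded induction: the value of `c` is fixed at minimal elements, and elsewhere by its
      -- value at a predecessor. So any order and any `c` that an existential quantifier returns
      -- give the same sum at a greatest element.
      steps-unique : ∀ {c g} → (∀ a → IsStep c a (g a)) → ∀ a → c a ≈ partialSum g a
      steps-unique {c} {g} steps a =
        ≡.subst (λ x → c x ≈ partialSum g x) (elem-rank a) (go (◁-wellFounded (rank a)))
        where
        go : ∀ {i} → Acc (λ i j → elem i ◁ elem j) i → c (elem i) ≈ partialSum g (elem i)
        go {i} (acc rs) with steps (elem i)
        ... | inj₁ (min , ca≈ga) = trans ca≈ga (sym (partialSum-minimal g min))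
        ... | inj₂ (b , pred , ca≈cb+ga) = begin
          c (elem i)                       ≈⟨ ca≈cb+ga ⟩
          c b + g (elem i)                 ≈⟨ +-congʳ cb≈ ⟩
          partialSum g b + g (elem i)      ≈⟨ partialSum-predecessor irrefl g pred ⟨
          partialSum g (elem i)            ∎
          where
          b◁a : b ◁ elem i
          -- At `b` itself the second alternative of `pred` would claim b ≠ b.
          b◁a = [ proj₁ , (λ (_ , b≢b , _) → ⊥-elim (b≢b ≡.refl)) ]′ (pred b)
          cb≈ : c b ≈ partialSum g b
          cb≈ = ≡.subst (λ x → c x ≈ partialSum g x) (elem-rank b)
                  (go (rs (≡.subst (_◁ elem i) (≡.sym (elem-rank b)) b◁a)))

    -- Partial sums along the order of ranks

    module _ (◁⇔< : ∀ {a b} → a ◁ b ⇔ rank a Fin.< rank b) where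

      <⇒irrefl : ∀ a → ¬ a ◁ a
      <⇒irrefl a a◁a = ℕ.<-irrefl ≡.refl (to ◁⇔< a◁a)

      <⇒trans : ∀ {a b c} → a ◁ b → b ◁ c → a ◁ c
      <⇒trans a◁b b◁c = from ◁⇔< (ℕ.<-trans (to ◁⇔< a◁b) (to ◁⇔< b◁c))

      <⇒greatest : Greatest (elem (fromℕ size-1))
      <⇒greatest x with ℕ.m≤n⇒m<n∨m≡n (Fin.≤fromℕ (rank x))
      ... | inj₁ x<m = inj₂ (from ◁⇔< (≡.subst (rank x Fin.<_) (≡.sym (rank-elem _)) x<m))
      ... | inj₂ x≡m = inj₁ (≡.trans (≡.sym (elem-rank x)) (≡.cong elem (Fin.toℕ-injective x≡m)))

      -- A rank below i + 1 is i or below i. Conversely the element of rank `i` lies below `a`, so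
      -- by transitivity whatever is not below `a` is neither that element nor below it.
      <⇒predecessor : ∀ {a} {i : Fin size-1} → rank a ≡ suc i → IsPredecessor (elem (inject₁ i)) a
      <⇒predecessor {a} {i} ra≡1+i x with em {x ◁ a}
      ... | yes x◁a = inj₁ (x◁a , Sum.swap (Sum.map lt eq (ℕ.m≤n⇒m<n∨m≡n (ℕ.s≤s⁻¹ x<1+i))))
        where
        x<1+i : rank x Fin.< suc i
        x<1+i = ≡.subst (rank x Fin.<_) ra≡1+i (to ◁⇔< x◁a)
        lt : toℕ (rank x) ℕ.< toℕ i → x ◁ elem (inject₁ i)
        lt x<i = from ◁⇔< (≡.subst (rank x Fin.<_) (≡.sym (rank-elem _))
                   (≡.subst (toℕ (rank x) ℕ.<_) (≡.sym (Fin.toℕ-inject₁ i)) x<i))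
        eq : toℕ (rank x) ≡ toℕ i → x ≡ elem (inject₁ i)
        eq x≡i = ≡.trans (≡.sym (elem-rank x))
                   (≡.cong elem (Fin.toℕ-injective (≡.trans x≡i (≡.sym (Fin.toℕ-inject₁ i)))))
      ... | no ¬x◁a = inj₂ (¬x◁a , (λ { ≡.refl → ¬x◁a b◁a }) , λ x◁b → ¬x◁a (<⇒trans x◁b b◁a))
        where
        b◁a : elem (inject₁ i) ◁ a
        b◁a = from ◁⇔< (≡.subst₂ Fin._<_ (≡.sym (rank-elem _)) (≡.sym ra≡1+i)
                (ℕ.s≤s (ℕ.≤-reflexive (Fin.toℕ-inject₁ i))))

      <⇒step : ∀ g a → IsStep (partialSum g) a (g a)
      <⇒step g a with rank a in ra≡
      ... | zero  = inj₁ (min , partialSum-minimal g min)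
        where
        min : Minimal a
        min b b◁a with ≡.subst (rank b Fin.<_) ra≡ (to ◁⇔< b◁a)
        ... | ()
      ... | suc i = inj₂ (elem (inject₁ i) , pred , partialSum-predecessor <⇒irrefl g pred)
        where
        pred = <⇒predecessor ra≡

-- Numerical expressions with sums and conditions

data Num (Γ : List ℕ) (n : ℕ) : Set where
  app     : ∀ {k} → k ∈ Γ → Vec (Fin n) k → Num Γ n
  zeroₙ oneₙ : Num Γ n
  _⊞_ _⊠_ : Num Γ n → Num Γ n → Num Γ n
  log     : Num Γ n → Num Γ n
  ∑ₙ      : Num Γ (suc n) → Num Γ n
  _given_≐_ : ∀ {k} → Num Γ n → Vec (Fin n) k → Vec (Fin n) k → Num Γ n

-- `graph` descends under function quantifiers while the expression stays over its original context;
-- composing with `there` does the weakening, without an operation on `Num`.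
Renaming : List ℕ → List ℕ → Set
Renaming Γ Δ = ∀ {k} → k ∈ Γ → k ∈ Δ

module _ {τ : Vocabulary} where

  equal unequal : ∀ {Γ n k} → Vec (Fin n) k → Vec (Fin n) k → SO τ Γ n
  -- Formulas have no truth constants; ∀x x = x and, for `unequal`, ∃x x ≠ x stand in for them.
  equal []       []       = ∀¹ (zero ≐ᶠ zero)
  equal (x ∷ xs) (y ∷ ys) = (x ≐ᶠ y) ∧ equal xs ys
  unequal []       []       = ∃¹ (zero ≠ᶠ zero)
  unequal (x ∷ xs) (y ∷ ys) = (x ≠ᶠ y) ∨ unequal xs ys

  -- The strict order a ◁ b is coded by a function L as L(a,b) = 0.
  less notLess : ∀ {Γ n} → 2 ∈ Γ → Fin n → Fin n → SO τ Γ n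
  less L x y    = app L (x ∷ y ∷ []) ≐ⁿ (app L (x ∷ y ∷ []) ⊞ app L (x ∷ y ∷ []))
  notLess L x y = app L (x ∷ y ∷ []) ≠ⁿ (app L (x ∷ y ∷ []) ⊞ app L (x ∷ y ∷ []))

  -- Unfolds to `IsStep` for the relation coded by `L`. The point `a` is `0F` at first, `1F` once
  -- its predecessor is bound, and `2F` under the innermost quantifier.
  step : ∀ {Γ n} → 2 ∈ Γ → 1 ∈ Γ → 0 ∈ Γ → SO τ Γ (suc n)
  step L c w =
    (∀¹ (notLess L 0F 1F) ∧ (app c (0F ∷ []) ≐ⁿ app w [])) ∨
    ∃¹ (∀¹ ((less L 0F 2F ∧ ((0F ≐ᶠ 1F) ∨ less L 0F 1F)) ∨
            (notLess L 0F 2F ∧ ((0F ≠ᶠ 1F) ∧ notLess L 0F 1F))) ∧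
        (app c (1F ∷ []) ≐ⁿ (app c (0F ∷ []) ⊞ app w [])))

  -- The graph of an expression, with its value held by the nullary function v.
  graph : ∀ {Γ Δ n} → Num Γ n → Renaming Γ Δ → 0 ∈ Δ → SO τ Δ n
  graph (app f xs) σ v = app v [] ≐ⁿ app (σ f) xs
  graph zeroₙ σ v = app v [] ≐ⁿ (app v [] ⊞ app v [])
  graph oneₙ σ v = ((app v [] ⊠ app v []) ≐ⁿ app v []) ∧ (app v [] ≠ⁿ (app v [] ⊞ app v []))
  graph (s ⊞ t) σ v = ∃² 0 (∃² 0 (
    graph s (there ∘ there ∘ σ) (there (here ≡.refl)) ∧
    graph t (there ∘ there ∘ σ) (here ≡.refl) ∧
    (app (there (there v)) [] ≐ⁿ (app (there (here ≡.refl)) [] ⊞ app (here ≡.refl) []))))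
  graph (s ⊠ t) σ v = ∃² 0 (∃² 0 (
    graph s (there ∘ there ∘ σ) (there (here ≡.refl)) ∧
    graph t (there ∘ there ∘ σ) (here ≡.refl) ∧
    (app (there (there v)) [] ≐ⁿ (app (there (here ≡.refl)) [] ⊠ app (here ≡.refl) []))))
  graph (log t) σ v = ∃² 0 (
    graph t (there ∘ σ) (here ≡.refl) ∧ (app (there v) [] ≐ⁿ log (app (here ≡.refl) [])))
  graph (∑ₙ t) σ v = ∃² 2 (∃² 1 (
    ∀¹ (notLess L 0F 0F) ∧
    -- Transitivity, with the implication as a disjunction.
    ∀¹ (∀¹ (∀¹ ((notLess L 2F 1F ∨ notLess L 1F 0F) ∨ less L 2F 0F))) ∧
    ∀¹ (∃² 0 (graph t (there ∘ there ∘ there ∘ σ) (here ≡.refl) ∧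
              step (there L) (there c) (here ≡.refl))) ∧
    ∃¹ (∀¹ ((0F ≐ᶠ 1F) ∨ less L 0F 1F) ∧
        (app (there (there v)) [] ≐ⁿ app c (0F ∷ [])))))
    where
    L = there (here ≡.refl)
    c = here ≡.refl
  graph (t given xs ≐ ys) σ v =
    (equal xs ys ∧ graph t σ v) ∨ (unequal xs ys ∧ graph zeroₙ σ v)

  equal-isESO : ∀ {Γ n k} (xs ys : Vec (Fin n) k) → IsESO (equal {Γ} xs ys)
  equal-isESO []       []       = tt
  equal-isESO (x ∷ xs) (y ∷ ys) = tt , equal-isESO xs ys

  unequal-isESO : ∀ {Γ n k} (xs ys : Vec (Fin n) k) → IsESO (unequal {Γ} xs ys)
  unequal-isESO []       []       = tt
  unequal-isESO (x ∷ xs) (y ∷ ys) = tt , unequal-isESO xs ys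

  graph-isESO : ∀ {Γ Δ n} (t : Num Γ n) (σ : Renaming Γ Δ) v → IsESO (graph t σ v)
  graph-isESO (app f xs) σ v = tt
  graph-isESO zeroₙ      σ v = tt
  graph-isESO oneₙ       σ v = tt , tt
  graph-isESO (s ⊞ t)    σ v = graph-isESO s _ _ , graph-isESO t _ _ , tt
  graph-isESO (s ⊠ t)    σ v = graph-isESO s _ _ , graph-isESO t _ _ , tt
  graph-isESO (log t)    σ v = graph-isESO t _ _ , tt
  graph-isESO (∑ₙ t)     σ v = tt , ((tt , tt) , tt) , (graph-isESO t _ _ , _) , _
  graph-isESO (t given xs ≐ ys) σ v =
    (equal-isESO xs ys , graph-isESO t σ v) , (unequal-isESO xs ys , tt)

-- Values of numerical expressions and correctness of their graphs

module Numbers (em : ExcludedMiddle 0ℓ) (R : RealNumbers) {τ : Vocabulary} (𝒜 : Structure τ) where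

  open RealNumbers R
  open OrderedField em R
  open Structure 𝒜
  open Semantics R
  open Teams 𝒜
  open Sums em R 𝒜

  -- With interpretations as functions on memberships, extending the environment and composing the
  -- renaming with `there` cancel definitionally, so induction hypotheses under quantifiers need no
  -- transport.
  Interpretation : List ℕ → Set
  Interpretation Γ = ∀ {k} → k ∈ Γ → Vec Universe k → ℝ

  _after_ : ∀ {Γ Δ} → FunctionEnv 𝒜 Δ → Renaming Γ Δ → Interpretation Γ
  (ρ after σ) f = All.lookup ρ (σ f)

  value : ∀ {Γ n} → Interpretation Γ → Vec Universe n → Num Γ n → ℝ
  value η e (app f xs) = η f (Vec.map (Vec.lookup e) xs)
  value η e zeroₙ      = 0#
  value η e oneₙ       = 1#
  value η e (s ⊞ t)    = value η e s + value η e t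
  value η e (s ⊠ t)    = value η e s * value η e t
  value η e (log t)    = log₂ (value η e t)
  value η e (∑ₙ t)     = ∑ λ a → value η (a ∷ e) t
  value η e (t given xs ≐ ys) =
    value η e t when (Vec.map (Vec.lookup e) xs ≟ᵛ Vec.map (Vec.lookup e) ys)

  module _ {Δ n} (ρ : FunctionEnv 𝒜 Δ) (e : Vec Universe n) where

    equal⇔ : ∀ {k} (xs ys : Vec (Fin n) k) →
             satSO 𝒜 ρ e (equal xs ys) ⇔ Vec.map (Vec.lookup e) xs ≡ Vec.map (Vec.lookup e) ys
    equal⇔ []       []       = mk⇔ (λ _ → ≡.refl) (λ _ a → ≡.refl)
    equal⇔ (x ∷ xs) (y ∷ ys) = mk⇔
      (λ (x≡y , eqs) → ≡.cong₂ _∷_ x≡y (to (equal⇔ xs ys) eqs))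
      (λ eq → Vec.∷-injectiveˡ eq , from (equal⇔ xs ys) (Vec.∷-injectiveʳ eq))

    unequal⇔ : ∀ {k} (xs ys : Vec (Fin n) k) →
               satSO 𝒜 ρ e (unequal xs ys) ⇔ (¬ Vec.map (Vec.lookup e) xs ≡ Vec.map (Vec.lookup e) ys)
    unequal⇔ []       []       = mk⇔ (λ (a , a≢a) → ⊥-elim (a≢a ≡.refl)) (λ neq → ⊥-elim (neq ≡.refl))
    unequal⇔ (x ∷ xs) (y ∷ ys) = mk⇔
      [ (λ x≢y → x≢y ∘ Vec.∷-injectiveˡ) , (λ neqs → to (unequal⇔ xs ys) neqs ∘ Vec.∷-injectiveʳ) ]′
      backward
      where
      backward : ¬ Vec.map (Vec.lookup e) (x ∷ xs) ≡ Vec.map (Vec.lookup e) (y ∷ ys) →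
                 satSO 𝒜 ρ e (unequal (x ∷ xs) (y ∷ ys))
      backward neq with Vec.lookup e x ≟ Vec.lookup e y
      ... | yes x≡y = inj₂ (from (unequal⇔ xs ys) λ eqs → neq (≡.cong₂ _∷_ x≡y eqs))
      ... | no  x≢y = inj₁ x≢y

  -- Zero codes "less", hence the value 1 where the comparison of ranks fails.
  orderFunction : Vec Universe 2 → ℝ
  orderFunction (a ∷ b ∷ []) = 1# when ¬? (rank a Fin.<? rank b)

  relationOf : (Vec Universe 2 → ℝ) → Universe → Universe → Set
  relationOf L a b = L (a ∷ b ∷ []) ≈ L (a ∷ b ∷ []) + L (a ∷ b ∷ [])

  orderFunction-correct : ∀ {a b} → relationOf orderFunction a b ⇔ rank a Fin.< rank b
  orderFunction-correct {a} {b} = mk⇔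
    (λ L≈L+L → decidable-stable (rank a Fin.<? rank b) λ a≮b →
      let L≈1 = when-true (¬? (rank a Fin.<? rank b)) a≮b in
      1≉1+1 (trans (sym L≈1) (trans L≈L+L (+-cong L≈1 L≈1))))
    (λ a<b → x≈0⇒x≈x+x (when-false (¬? (rank a Fin.<? rank b)) (λ a≮b → a≮b a<b)))

  IsStep-resp : ∀ {_◁_ c a x y} → x ≈ y → PartialSums.IsStep _◁_ c a x → PartialSums.IsStep _◁_ c a y
  IsStep-resp x≈y = Sum.map
    (λ (min , eq) → min , trans eq x≈y)
    (λ (b , pred , eq) → b , pred , trans eq (+-congˡ x≈y))

  -- The witnesses are not unique, but the value is: in the sum case `L` may be any strict order
  -- satisfying the formula, and `steps-unique` makes the last entry of `c` independent of it.
  graph-sound : ∀ {Γ Δ n} (ρ : FunctionEnv 𝒜 Δ) (e : Vec Universe n) (t : Num Γ n) (σ : Renaming Γ Δ) v →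
                satSO 𝒜 ρ e (graph t σ v) → All.lookup ρ v [] ≈ value (ρ after σ) e t
  graph-sound ρ e (app f xs) σ v eq = eq
  graph-sound ρ e zeroₙ      σ v eq = x≈x+x⇒x≈0 eq
  graph-sound ρ e oneₙ       σ v (eq , neq) = idempotent⇒≈1 eq neq
  graph-sound ρ e (s ⊞ t)    σ v (x , y , x≈s , y≈t , eq) =
    trans eq (+-cong (graph-sound _ e s _ _ x≈s) (graph-sound _ e t _ _ y≈t))
  graph-sound ρ e (s ⊠ t)    σ v (x , y , x≈s , y≈t , eq) =
    trans eq (*-cong (graph-sound _ e s _ _ x≈s) (graph-sound _ e t _ _ y≈t))
  graph-sound ρ e (log t)    σ v (x , x≈t , eq) = trans eq (log₂-cong (graph-sound _ e t _ _ x≈t))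
  graph-sound ρ e (∑ₙ t)     σ v (L , c , irrefl , ◁-trans , steps , m , great , eq) =
    trans eq (trans (steps-unique irrefl ◁-trans′ {c = λ a → c (a ∷ [])} steps′ m)
                    (partialSum-greatest (λ a → value (ρ after σ) (a ∷ e) t) great))
    where
    open PartialSums (relationOf L)
    ◁-trans′ : ∀ {a b c} → relationOf L a b → relationOf L b c → relationOf L a c
    ◁-trans′ {a} {b} {c} a◁b b◁c =
      [ [ (λ ¬a◁b → ⊥-elim (¬a◁b a◁b)) , (λ ¬b◁c → ⊥-elim (¬b◁c b◁c)) ]′ , (λ a◁c → a◁c) ]′ (◁-trans a b c)
    steps′ : ∀ a → IsStep (λ a → c (a ∷ [])) a (value (ρ after σ) (a ∷ e) t)
    steps′ a = let w , w≈t , st = steps a in IsStep-resp (graph-sound _ (a ∷ e) t _ _ w≈t) st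
  graph-sound ρ e (t given xs ≐ ys) σ v (inj₁ (eq , v≈t)) =
    trans (graph-sound ρ e t σ v v≈t) (sym (when-true (_ ≟ᵛ _) (to (equal⇔ ρ e xs ys) eq)))
  graph-sound ρ e (t given xs ≐ ys) σ v (inj₂ (neq , v≈0)) =
    trans (x≈x+x⇒x≈0 v≈0) (sym (when-false (_ ≟ᵛ _) (to (unequal⇔ ρ e xs ys) neq)))

  graph-complete : ∀ {Γ Δ n} (ρ : FunctionEnv 𝒜 Δ) (e : Vec Universe n) (t : Num Γ n) (σ : Renaming Γ Δ) v →
                   All.lookup ρ v [] ≈ value (ρ after σ) e t → satSO 𝒜 ρ e (graph t σ v)
  graph-complete ρ e (app f xs) σ v eq = eq
  graph-complete ρ e zeroₙ      σ v eq = x≈0⇒x≈x+x eq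
  graph-complete ρ e oneₙ       σ v eq =
    trans (*-cong eq eq) (trans (*-identityˡ 1#) (sym eq)) ,
    λ v≈v+v → 1≉1+1 (trans (sym eq) (trans v≈v+v (+-cong eq eq)))
  graph-complete ρ e (s ⊞ t)    σ v eq =
    const (value (ρ after σ) e s) , const (value (ρ after σ) e t) ,
    graph-complete _ e s _ _ refl , graph-complete _ e t _ _ refl , eq
  graph-complete ρ e (s ⊠ t)    σ v eq =
    const (value (ρ after σ) e s) , const (value (ρ after σ) e t) ,
    graph-complete _ e s _ _ refl , graph-complete _ e t _ _ refl , eq
  graph-complete ρ e (log t)    σ v eq = const (value (ρ after σ) e t) , graph-complete _ e t _ _ refl , eq
  graph-complete ρ e (∑ₙ t)     σ v eq =
    -- The enumeration of the universe supplies the order, and its last element is the greatest.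
    orderFunction , (λ as → partialSum g (Vec.head as)) ,
    <⇒irrefl ◁⇔< , trans′ ,
    (λ a → const (g a) , graph-complete _ (a ∷ e) t _ _ refl , <⇒step ◁⇔< g a) ,
    elem (fromℕ size-1) , <⇒greatest ◁⇔< ,
    trans eq (sym (partialSum-greatest g (<⇒greatest ◁⇔<)))
    where
    _◁_ = relationOf orderFunction
    open PartialSums _◁_
    ◁⇔< : ∀ {a b} → a ◁ b ⇔ rank a Fin.< rank b
    ◁⇔< = orderFunction-correct
    g = λ a → value (ρ after σ) (a ∷ e) t
    trans′ : ∀ a b c → (¬ a ◁ b ⊎ ¬ b ◁ c) ⊎ a ◁ c
    trans′ a b c with em {a ◁ b} | em {b ◁ c}
    ... | no ¬a◁b | _        = inj₁ (inj₁ ¬a◁b)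
    ... | yes _   | no ¬b◁c  = inj₁ (inj₂ ¬b◁c)
    ... | yes a◁b | yes b◁c  = inj₂ (<⇒trans ◁⇔< a◁b b◁c)
  graph-complete ρ e (t given xs ≐ ys) σ v eq with Vec.map (Vec.lookup e) xs ≟ᵛ Vec.map (Vec.lookup e) ys
  ... | yes xs≡ys = inj₁ (from (equal⇔ ρ e xs ys) xs≡ys , graph-complete ρ e t σ v eq)
  ... | no  xs≢ys = inj₂ (from (unequal⇔ ρ e xs ys) xs≢ys , x≈0⇒x≈x+x eq)

-- The translation

-- Polymorphic copies of reading and updating an assignment: formulas apply them to tuples of
-- variables, the semantics to tuples of elements. Naturality (`map-select`, `map-update`) relates
-- the two uses.
select : ∀ {A : Set} {D m} → Vec A (length D) → Vec (VarOf D) m → Vec A m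
select s = Vec.map (λ x → Vec.lookup s (index (proj₂ x)))

update : ∀ {A : Set} D → Vec A (length D) → A → (x : Variable) → Vec A (length (D ⊕ x))
update D s a x with _∈?_ ℕ._≟_ x D
... | yes x∈D = s [ index x∈D ]≔ a
... | no  _   = a ∷ s

map-select : ∀ {A B : Set} {D m} (f : A → B) (s : Vec A (length D)) (xs : Vec (VarOf D) m) →
             Vec.map f (select s xs) ≡ select (Vec.map f s) xs
map-select f s xs = ≡.trans (≡.sym (Vec.map-∘ f _ xs))
  (Vec.map-cong (λ x → ≡.sym (Vec.lookup-map (index (proj₂ x)) f s)) xs)

map-update : ∀ {A B : Set} (f : A → B) D (s : Vec A (length D)) a x →
             Vec.map f (update D s a x) ≡ update D (Vec.map f s) (f a) x
map-update f D s a x with _∈?_ ℕ._≟_ x D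
... | yes x∈D = Vec.map-[]≔ f s (index x∈D)
... | no  _   = ≡.refl

-- In the scope of ∑* m, the summation variables and the outer variables.
inner : ∀ m {n} → Vec (Fin (m ℕ.+ n)) m
inner m {n} = Vec.map (_↑ˡ n) (allFin m)

outer : ∀ m {n k} → Vec (Fin n) k → Vec (Fin (m ℕ.+ n)) k
outer m = Vec.map (m ↑ʳ_)

module _ {Γ : List ℕ} where

  -- The new sum goes innermost, so that it binds variable 0, the first coordinate. `∑ᵛ` has that
  -- coordinate outermost, whence the exchange of sums in `value-∑*`.
  ∑* : ∀ {n} m → Num Γ (m ℕ.+ n) → Num Γ n
  ∑* zero    t = t
  ∑* (suc m) t = ∑* m (∑ₙ t)

  -- The `m` free variables are the tuple whose probability is taken; the type fits directly under
  -- `∑* m`.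
  marginal : ∀ {D m} → length D ∈ Γ → Vec (VarOf D) m → Num Γ (m ℕ.+ 0)
  marginal {D = D} {m} f xs = ∑* (length D) (app f s given select {D = D} s xs ≐ outer (length D) (inner m))
    where
    s = inner (length D)

  -- The sign is dropped for want of subtraction; equality of two entropies is unaffected. A
  -- marginal 0 needs no case distinction, being a factor of its own summand.
  negEntropy : ∀ {D m} → length D ∈ Γ → Vec (VarOf D) m → Num Γ 0
  negEntropy {D = D} {m} f xs = ∑* m (marginal {D = D} f xs ⊠ log (marginal {D = D} f xs))

module _ {τ : Vocabulary} where

  infix 4 _≐ᴺ_ _≤ᴺ_

  _≐ᴺ_ _≤ᴺ_ : ∀ {Γ n} → Num Γ n → Num Γ n → SO τ Γ n
  t ≐ᴺ u = ∃² 0 (graph t there (here ≡.refl) ∧ graph u there (here ≡.refl))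
  t ≤ᴺ u = ∃² 0 (∃² 0 (
    graph t (there ∘ there) (there (here ≡.refl)) ∧
    graph u (there ∘ there) (here ≡.refl) ∧
    ∃² 0 ((app (there (there (here ≡.refl))) [] ⊞ (app (here ≡.refl) [] ⊠ app (here ≡.refl) []))
          ≐ⁿ app (there (here ≡.refl)) [])))

  ∀* : ∀ {Γ} n → SO τ Γ n → SO τ Γ 0
  ∀* zero    φ = φ
  ∀* (suc n) φ = ∀* n (∀¹ φ)

  -- The implication from the support is a disjunction whose first part says that the weight is 0.
  onSupport : ∀ {Γ k} → k ∈ Γ → SO τ Γ k → SO τ Γ 0
  onSupport {k = k} f φ = ∀* k ((app f (allFin k) ≐ⁿ (app f (allFin k) ⊞ app f (allFin k))) ∨ φ)

  team : ∀ {Γ} k → k ∈ Γ → SO τ Γ 0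
  team k f =
    ∀* k (zeroₙ ≤ᴺ app f (allFin k)) ∧ ∀* k (app f (allFin k) ≤ᴺ oneₙ) ∧
    (∑* k (app f (inner k)) ≐ᴺ oneₙ)

  -- F(t)(a) is coded as F(a,t), with the value first, so that `∑ₙ` sums over it.
  distribution : ∀ {Γ} k → suc k ∈ Γ → SO τ Γ 0
  distribution k F =
    ∀* (suc k) (zeroₙ ≤ᴺ app F (allFin (suc k))) ∧ ∀* (suc k) (app F (allFin (suc k)) ≤ᴺ oneₙ) ∧
    ∀* k (∑ₙ (app F (allFin (suc k))) ≐ᴺ oneₙ)

  -- The summand does not depend on the bound variable, so the sum is |A| F(t)(a).
  uniformDistribution : ∀ {Γ} k → suc k ∈ Γ → SO τ Γ 0
  uniformDistribution k F = ∀* (suc k) (∑ₙ (app F (Vec.map suc (allFin (suc k)))) ≐ᴺ oneₙ)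

  reweighting : ∀ {Γ} D x → length D ∈ Γ → suc (length D) ∈ Γ → length (D ⊕ x) ∈ Γ → SO τ Γ 0
  reweighting D x f F g =
    ∀* (length (D ⊕ x)) (
      app g (allFin _) ≐ᴺ
      ∑* (length D) ((app f t ⊠ app F (a ∷ t)) given update D t a x ≐ outer (length D) (allFin _)))
    where
    t = inner (length D)
    -- The variable of the outer assignment s that holds s(x), the only value with which t can be
    -- updated to s.
    a = length D ↑ʳ index (∈-⊕ D x)

  -- `κ′` stands for 1 - κ; that the two add up to 1 is a separate conjunct in `translate`.
  mixture : ∀ {Γ} k → k ∈ Γ → 0 ∈ Γ → k ∈ Γ → 0 ∈ Γ → k ∈ Γ → SO τ Γ 0
  mixture k g κ h κ′ f =
    ∀* k ((app κ [] ⊠ app g (allFin k)) ⊞ (app κ′ [] ⊠ app h (allFin k)) ≐ᴺ app f (allFin k))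

  -- Negation pushed to the atoms. It exchanges the two function quantifiers, so it can leave the
  -- existential fragment.
  dual : ∀ {Γ n} → SO τ Γ n → SO τ Γ n
  dual (x ≐ᶠ y)    = x ≠ᶠ y
  dual (x ≠ᶠ y)    = x ≐ᶠ y
  dual (i ≐ⁿ j)    = i ≠ⁿ j
  dual (i ≠ⁿ j)    = i ≐ⁿ j
  dual (rel P xs)  = ¬rel P xs
  dual (¬rel P xs) = rel P xs
  dual (φ ∧ ψ)     = dual φ ∨ dual ψ
  dual (φ ∨ ψ)     = dual φ ∧ dual ψ
  dual (∃¹ φ)      = ∀¹ (dual φ)
  dual (∀¹ φ)      = ∃¹ (dual φ)
  dual (∃² k φ)    = ∀² k (dual φ)
  dual (∀² k φ)    = ∃² k (dual φ)

  translate : ∀ {Γ D} → Formula τ D → length D ∈ Γ → SO τ Γ 0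
  translate (x ≐ y)     f = onSupport f (index (proj₂ x) ≐ᶠ index (proj₂ y))
  translate (x ≠ y)     f = onSupport f (index (proj₂ x) ≠ᶠ index (proj₂ y))
  translate (rel P xs)  f = onSupport f (rel P (Vec.map (index ∘ proj₂) xs))
  translate (¬rel P xs) f = onSupport f (¬rel P (Vec.map (index ∘ proj₂) xs))
  translate {D = D} H[ xs ]≐H[ ys ] f = negEntropy {D = D} f xs ≐ᴺ negEntropy {D = D} f ys
  translate (φ ∧ ψ)     f = translate φ f ∧ translate ψ f
  translate {D = D} (φ ∨ ψ) f = ∃² (length D) (∃² (length D) (∃² 0 (∃² 0 (
    team (length D) g ∧ team (length D) h ∧
    (zeroₙ ≤ᴺ app κ []) ∧ (app κ [] ≤ᴺ oneₙ) ∧ (app κ [] ⊞ app κ′ [] ≐ᴺ oneₙ) ∧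
    mixture (length D) g κ h κ′ (there (there (there (there f)))) ∧
    translate φ g ∧ translate ψ h))))
    where
    g  = there (there (there (here ≡.refl)))
    h  = there (there (here ≡.refl))
    κ  = there (here ≡.refl)
    κ′ = here ≡.refl
  translate {D = D} (∃′ x φ) f = ∃² (suc (length D)) (distribution (length D) (here ≡.refl) ∧
    ∃² (length (D ⊕ x)) (
      reweighting D x (there (there f)) (there (here ≡.refl)) (here ≡.refl) ∧
      translate φ (here ≡.refl)))
  -- The function is quantified only to name the uniform distribution. Its condition determines it,
  -- so an existential quantifier suffices.
  translate {D = D} (∀′ x φ) f = ∃² (suc (length D)) (uniformDistribution (length D) (here ≡.refl) ∧
    ∃² (length (D ⊕ x)) (
      reweighting D x (there (there f)) (there (here ≡.refl)) (here ≡.refl) ∧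
      translate φ (here ≡.refl)))
  translate (∼ φ)       f = dual (translate φ f)

  -- Membership in the existential fragment

  ≐ᴺ-isESO : ∀ {Γ n} (t u : Num Γ n) → IsESO (t ≐ᴺ u)
  ≐ᴺ-isESO t u = graph-isESO t _ _ , graph-isESO u _ _

  ∀*-isESO : ∀ {Γ} n (φ : SO τ Γ n) → IsESO φ → IsESO (∀* n φ)
  ∀*-isESO zero    φ p = p
  ∀*-isESO (suc n) φ p = ∀*-isESO n (∀¹ φ) p

  onSupport-isESO : ∀ {Γ k} (f : k ∈ Γ) (φ : SO τ Γ k) → IsESO φ → IsESO (onSupport f φ)
  onSupport-isESO {k = k} f φ p = ∀*-isESO k (_ ∨ φ) (tt , p)

  team-isESO : ∀ {Γ} k (f : k ∈ Γ) → IsESO (team k f)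
  team-isESO k f =
    ∀*-isESO k (zeroₙ ≤ᴺ app f (allFin k)) _ , ∀*-isESO k (app f (allFin k) ≤ᴺ oneₙ) _ ,
    ≐ᴺ-isESO (∑* k (app f (inner k))) oneₙ

  distribution-isESO : ∀ {Γ} k (F : suc k ∈ Γ) → IsESO (distribution k F)
  distribution-isESO k F =
    ∀*-isESO (suc k) (zeroₙ ≤ᴺ app F (allFin (suc k))) _ ,
    ∀*-isESO (suc k) (app F (allFin (suc k)) ≤ᴺ oneₙ) _ ,
    ∀*-isESO k φ (≐ᴺ-isESO (∑ₙ (app F (allFin (suc k)))) oneₙ)
    where
    φ = ∑ₙ (app F (allFin (suc k))) ≐ᴺ oneₙ

  uniformDistribution-isESO : ∀ {Γ} k (F : suc k ∈ Γ) → IsESO (uniformDistribution k F)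
  uniformDistribution-isESO k F = ∀*-isESO (suc k) (t ≐ᴺ oneₙ) (≐ᴺ-isESO t oneₙ)
    where
    t = ∑ₙ (app F (Vec.map suc (allFin (suc k))))

  reweighting-isESO : ∀ {Γ} D x (f : length D ∈ Γ) F g → IsESO (reweighting D x f F g)
  reweighting-isESO D x f F g =
    ∀*-isESO (length (D ⊕ x)) (s ≐ᴺ ∑* (length D) t) (≐ᴺ-isESO s (∑* (length D) t))
    where
    s = app g (allFin (length (D ⊕ x)))
    t = _ given _ ≐ outer (length D) (allFin (length (D ⊕ x)))

  mixture-isESO : ∀ {Γ} k (g : k ∈ Γ) κ h κ′ f → IsESO (mixture k g κ h κ′ f)
  mixture-isESO k g κ h κ′ f =
    ∀*-isESO k ((app κ [] ⊠ app g (allFin k)) ⊞ (app κ′ [] ⊠ app h (allFin k)) ≐ᴺ app f (allFin k)) _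

  translate-isESO : ∀ {Γ D} (φ : Formula τ D) (f : length D ∈ Γ) → IsFO[H] φ → IsESO (translate φ f)
  translate-isESO (x ≐ y)     f _ = onSupport-isESO f (_ ≐ᶠ _) tt
  translate-isESO (x ≠ y)     f _ = onSupport-isESO f (_ ≠ᶠ _) tt
  translate-isESO (rel P xs)  f _ = onSupport-isESO f (rel P _) tt
  translate-isESO (¬rel P xs) f _ = onSupport-isESO f (¬rel P _) tt
  translate-isESO {D = D} H[ xs ]≐H[ ys ] f _ =
    ≐ᴺ-isESO (negEntropy {D = D} f xs) (negEntropy {D = D} f ys)
  translate-isESO (φ ∧ ψ)     f (p , q) = translate-isESO φ f p , translate-isESO ψ f q
  translate-isESO {D = D} (φ ∨ ψ) f (p , q) =
    team-isESO (length D) _ , team-isESO (length D) _ , _ , _ , _ , mixture-isESO (length D) _ _ _ _ _ ,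
    translate-isESO φ _ p , translate-isESO ψ _ q
  translate-isESO {D = D} (∃′ x φ) f p =
    distribution-isESO (length D) _ , reweighting-isESO D x _ _ _ , translate-isESO φ _ p
  translate-isESO {D = D} (∀′ x φ) f p =
    uniformDistribution-isESO (length D) _ , reweighting-isESO D x _ _ _ , translate-isESO φ _ p

-- Correctness of the translation

lookup-inner : ∀ {A : Set} {m n} (xs : Vec A m) (ys : Vec A n) →
               Vec.map (Vec.lookup (xs ++ ys)) (inner m) ≡ xs
lookup-inner xs ys = ≡.trans (≡.sym (Vec.map-∘ _ _ (allFin _)))
  (≡.trans (Vec.map-cong (Vec.lookup-++ˡ xs ys) (allFin _)) (Vec.map-lookup-allFin xs))

lookup-outer : ∀ {A : Set} {m n k} (xs : Vec A m) (ys : Vec A n) (is : Vec (Fin n) k) →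
               Vec.map (Vec.lookup (xs ++ ys)) (outer m is) ≡ Vec.map (Vec.lookup ys) is
lookup-outer xs ys is = ≡.trans (≡.sym (Vec.map-∘ _ _ is)) (Vec.map-cong (Vec.lookup-++ʳ xs ys) is)

module Correctness (em : ExcludedMiddle 0ℓ) (R : RealNumbers) {τ : Vocabulary} (𝒜 : Structure τ) where

  open RealNumbers R
  open OrderedField em R
  open Structure 𝒜
  open Semantics R
  open Teams 𝒜 hiding (Weighting; IsTeam)
  open Sums em R 𝒜
  open Numbers em R 𝒜
  open Algebra.Properties.Ring ring using (-‿injective; xyx⁻¹≈y)
  open Relation.Binary.Reasoning.Setoid setoid

  update-correct : ∀ D s a x → D ⊢ s [ a / x ] ≡ update D s a x
  update-correct D s a x with _∈?_ ℕ._≟_ x D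
  ... | yes _ = ≡.refl
  ... | no  _ = ≡.refl

  -- The values enter only up to `≈`, so that a caller can put the semantic quantities directly for
  -- `x` and `y`.
  ≐ᴺ-correct : ∀ {Γ n} (ρ : FunctionEnv 𝒜 Γ) (e : Vec Universe n) (t u : Num Γ n) {x y} →
               value (ρ after id) e t ≈ x → value (ρ after id) e u ≈ y → satSO 𝒜 ρ e (t ≐ᴺ u) ⇔ x ≈ y
  ≐ᴺ-correct ρ e t u t≈x u≈y = mk⇔
    (λ (v , v≈t , v≈u) → begin
      _                    ≈⟨ t≈x ⟨
      value (ρ after id) e t  ≈⟨ graph-sound _ e t _ _ v≈t ⟨
      v []                 ≈⟨ graph-sound _ e u _ _ v≈u ⟩
      value (ρ after id) e u  ≈⟨ u≈y ⟩
      _                    ∎)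
    (λ x≈y → const (value (ρ after id) e t) ,
      graph-complete _ e t _ _ refl , graph-complete _ e u _ _ (trans t≈x (trans x≈y (sym u≈y))))

  ≤ᴺ-correct : ∀ {Γ n} (ρ : FunctionEnv 𝒜 Γ) (e : Vec Universe n) (t u : Num Γ n) {x y} →
               value (ρ after id) e t ≈ x → value (ρ after id) e u ≈ y → satSO 𝒜 ρ e (t ≤ᴺ u) ⇔ x ≤ y
  ≤ᴺ-correct ρ e t u {x} {y} t≈x u≈y = mk⇔
    (λ (v , w , v≈t , w≈u , z , v+zz≈w) → x+z*z≈y⇒x≤y (begin
      x + z [] * z []      ≈⟨ +-congʳ (trans (graph-sound _ e t _ _ v≈t) t≈x) ⟨
      v [] + z [] * z []   ≈⟨ v+zz≈w ⟩
      w []                 ≈⟨ graph-sound _ e u _ _ w≈u ⟩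
      value (ρ after id) e u  ≈⟨ u≈y ⟩
      y                    ∎))
    (λ x≤y → let z , x+zz≈y = x≤y⇒∃z[x+z*z≈y] x≤y in
      const x , const y ,
      graph-complete _ e t _ _ (sym t≈x) , graph-complete _ e u _ _ (sym u≈y) , const z , x+zz≈y)

  ∀*-correct : ∀ {Γ n} (ρ : FunctionEnv 𝒜 Γ) (φ : SO τ Γ n) {P : Vec Universe n → Set} →
               (∀ e → satSO 𝒜 ρ e φ ⇔ P e) → satSO 𝒜 ρ [] (∀* n φ) ⇔ (∀ e → P e)
  ∀*-correct {n = zero}  ρ φ φ⇔P = mk⇔ (λ { p [] → to (φ⇔P []) p }) (λ p → from (φ⇔P []) (p []))
  ∀*-correct {n = suc n} ρ φ {P} φ⇔P = mk⇔
    (λ { p (a ∷ e) → to rec p e a })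
    (λ p → from rec λ e a → p (a ∷ e))
    where
    rec : satSO 𝒜 ρ [] (∀* n (∀¹ φ)) ⇔ (∀ e a → P (a ∷ e))
    rec = ∀*-correct ρ (∀¹ φ) λ e → mk⇔ (λ p a → to (φ⇔P (a ∷ e)) (p a)) (λ p a → from (φ⇔P (a ∷ e)) (p a))

  value-∑* : ∀ {Γ n} (η : Interpretation Γ) (e : Vec Universe n) m (t : Num Γ (m ℕ.+ n)) →
             value η e (∑* m t) ≈ ∑ᵛ λ as → value η (as ++ e) t
  value-∑* η e zero    t = refl
  value-∑* η e (suc m) t = trans (value-∑* η e m (∑ₙ t)) (sym (∑-∑ᵛ-comm λ a as → value η (a ∷ as ++ e) t))

  at-allFin : ∀ {k} (g : Vec Universe k → ℝ) e → g (Vec.map (Vec.lookup e) (allFin k)) ≈ g e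
  at-allFin g e = reflexive (≡.cong g (Vec.map-lookup-allFin e))

  at-inner : ∀ {m n} (g : Vec Universe m → ℝ) as (e : Vec Universe n) →
             g (Vec.map (Vec.lookup (as ++ e)) (inner m)) ≈ g as
  at-inner g as e = reflexive (≡.cong g (lookup-inner as e))

  when-≡ : ∀ {k} {xs xs′ ys ys′ : Vec Universe k} {x y} → xs ≡ xs′ → ys ≡ ys′ → x ≈ y →
           x when (xs ≟ᵛ ys) ≈ y when (xs′ ≟ᵛ ys′)
  when-≡ {xs = xs} {ys = ys} ≡.refl ≡.refl x≈y = when-congˡ (xs ≟ᵛ ys) x≈y

  onSupport-correct : ∀ {Γ k} (ρ : FunctionEnv 𝒜 Γ) (f : k ∈ Γ) (φ : SO τ Γ k) {𝕏 : Vec Universe k → ℝ}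
                      {P : Vec Universe k → Set} → (∀ s → 𝕏 s ≈ All.lookup ρ f s) →
                      (∀ s → satSO 𝒜 ρ s φ ⇔ P s) →
                      (∀ s → supp 𝕏 s → P s) ⇔ satSO 𝒜 ρ [] (onSupport f φ)
  onSupport-correct ρ f φ {𝕏} {P} 𝕏≈f φ⇔P = mk⇔ (from eqv) (to eqv)
    where
    ifSupp : ∀ s → satSO 𝒜 ρ s ((app f (allFin _) ≐ⁿ (app f (allFin _) ⊞ app f (allFin _))) ∨ φ) ⇔
                   (supp 𝕏 s → P s)
    ifSupp s = mk⇔
      [ (λ f≈0 s∈𝕏 → ⊥-elim (s∈𝕏 (trans (𝕏≈f s) (trans (sym (at-allFin (All.lookup ρ f) s)) (x≈x+x⇒x≈0 f≈0)))))
      , (λ p _ → to (φ⇔P s) p) ]′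
      backward
      where
      backward : (supp 𝕏 s → P s) → _
      backward p with em {𝕏 s ≈ 0#}
      ... | yes 𝕏s≈0 = inj₁ (x≈0⇒x≈x+x (trans (at-allFin (All.lookup ρ f) s) (trans (sym (𝕏≈f s)) 𝕏s≈0)))
      ... | no  𝕏s≉0 = inj₂ (from (φ⇔P s) (p 𝕏s≉0))
    eqv = ∀*-correct ρ _ ifSupp

  lookup-variables : ∀ {D m} (s : Vec Universe (length D)) (xs : Vec (VarOf D) m) →
                     Vec.map (Vec.lookup s) (Vec.map (index ∘ proj₂) xs) ≡ select {D = D} s xs
  lookup-variables s xs = ≡.sym (Vec.map-∘ (Vec.lookup s) (index ∘ proj₂) xs)

  -- Entropies, teams, distributions and the operations on teams

  module _ {Γ} (ρ : FunctionEnv 𝒜 Γ) where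

    private
      ⟪_⟫ : ∀ {k} → k ∈ Γ → Vec Universe k → ℝ
      ⟪ f ⟫ = All.lookup ρ f

    marginal-correct : ∀ {D m} (f : length D ∈ Γ) {𝕏} → (∀ s → 𝕏 s ≈ ⟪ f ⟫ s) →
                       (xs : Vec (VarOf D) m) (as : Vec Universe m) →
                       value (ρ after id) (as ++ []) (marginal {D = D} f xs) ≈ ∣_∣[_≔_] {D} 𝕏 xs as
    marginal-correct {D} {m} f {𝕏} 𝕏≈f xs as = trans
      (value-∑* (ρ after id) (as ++ []) (length D) _)
      (∑ᵛ-cong λ s → when-≡
        (≡.trans (map-select {D = D} (Vec.lookup (s ++ as ++ [])) (inner (length D)) xs)
                 (≡.cong (λ s → select {D = D} s xs) (lookup-inner s (as ++ []))))
        (≡.trans (lookup-outer s (as ++ []) (inner m)) (lookup-inner as []))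
        (trans (at-inner ⟪ f ⟫ s (as ++ [])) (sym (𝕏≈f s))))

    negEntropy-correct : ∀ {D m} (f : length D ∈ Γ) {𝕏} → (∀ s → 𝕏 s ≈ ⟪ f ⟫ s) → (xs : Vec (VarOf D) m) →
                         - value (ρ after id) [] (negEntropy {D = D} f xs) ≈ entropy {D} 𝕏 xs
    negEntropy-correct {D} {m} f {𝕏} 𝕏≈f xs = -‿cong (trans
      (value-∑* (ρ after id) [] m (p ⊠ log p))
      (∑ᵛ-cong {h = λ as → ∣_∣[_≔_] {D} 𝕏 xs as * log₂ (∣_∣[_≔_] {D} 𝕏 xs as)} λ as →
        let p≈ = marginal-correct {D} f 𝕏≈f xs as in *-cong p≈ (log₂-cong p≈)))
      where
      p = marginal {D = D} f xs

    nonNegative-correct : ∀ {k} (f : k ∈ Γ) →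
                          (∀ s → 0# ≤ ⟪ f ⟫ s) ⇔ satSO 𝒜 ρ [] (∀* k (zeroₙ ≤ᴺ app f (allFin k)))
    nonNegative-correct f = ⇔-sym (∀*-correct ρ (zeroₙ ≤ᴺ app f (allFin _)) λ s →
      ≤ᴺ-correct ρ s zeroₙ (app f (allFin _)) refl (at-allFin ⟪ f ⟫ s))

    atMostOne-correct : ∀ {k} (f : k ∈ Γ) →
                        (∀ s → ⟪ f ⟫ s ≤ 1#) ⇔ satSO 𝒜 ρ [] (∀* k (app f (allFin k) ≤ᴺ oneₙ))
    atMostOne-correct f = ⇔-sym (∀*-correct ρ (app f (allFin _) ≤ᴺ oneₙ) λ s →
      ≤ᴺ-correct ρ s (app f (allFin _)) oneₙ (at-allFin ⟪ f ⟫ s) refl)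

    weights-correct : ∀ k (f : k ∈ Γ) →
                      ((∀ s → 0# ≤ ⟪ f ⟫ s) × (∀ s → ⟪ f ⟫ s ≤ 1#) × ∑ᵛ ⟪ f ⟫ ≈ 1#) ⇔ satSO 𝒜 ρ [] (team k f)
    weights-correct k f = nonNegative-correct f ×-⇔ (atMostOne-correct f ×-⇔ ⇔-sym total⇔)
      where
      total⇔ : satSO 𝒜 ρ [] (∑* k (app f (inner k)) ≐ᴺ oneₙ) ⇔ ∑ᵛ ⟪ f ⟫ ≈ 1#
      total⇔ = ≐ᴺ-correct ρ [] (∑* k (app f (inner k))) oneₙ
        (trans (value-∑* (ρ after id) [] k (app f (inner k)))
               (∑ᵛ-cong {h = ⟪ f ⟫} λ s → at-inner ⟪ f ⟫ s [])) refl

    team-correct : ∀ D (f : length D ∈ Γ) → IsTeam 𝒜 D ⟪ f ⟫ ⇔ satSO 𝒜 ρ [] (team (length D) f)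
    team-correct D f = weights-correct (length D) f ⇔-∘ mk⇔
      (λ 𝕏 → let open IsTeam 𝕏 in nonNegative , atMostOne , total)
      (λ (p , q , r) → record { nonNegative = p ; atMostOne = q ; total = r })

    distribution-correct : ∀ {k} (F : suc k ∈ Γ) →
                           (∀ t → IsDistribution λ a → ⟪ F ⟫ (a ∷ t)) ⇔ satSO 𝒜 ρ [] (distribution k F)
    distribution-correct {k} F =
      (nonNegative-correct F ×-⇔ (atMostOne-correct F ×-⇔ ⇔-sym total⇔)) ⇔-∘ mk⇔
        (λ p → (λ { (a ∷ t) → IsDistribution.nonNegative (p t) a }) ,
               (λ { (a ∷ t) → IsDistribution.atMostOne (p t) a }) ,
               (λ t → IsDistribution.total (p t)))
        (λ (p , q , r) t → record
          { nonNegative = λ a → p (a ∷ t) ; atMostOne = λ a → q (a ∷ t) ; total = r t })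
      where
      total⇔ : satSO 𝒜 ρ [] (∀* k (∑ₙ (app F (allFin (suc k))) ≐ᴺ oneₙ)) ⇔ (∀ t → (∑ λ a → ⟪ F ⟫ (a ∷ t)) ≈ 1#)
      total⇔ = ∀*-correct ρ (∑ₙ (app F (allFin (suc k))) ≐ᴺ oneₙ) λ t →
        ≐ᴺ-correct ρ t (∑ₙ (app F (allFin (suc k)))) oneₙ
          (∑-cong {h = λ a → ⟪ F ⟫ (a ∷ t)} λ a → at-allFin ⟪ F ⟫ (a ∷ t)) refl

    uniformDistribution-correct :
      ∀ {k} (F : suc k ∈ Γ) →
      (∀ t a → uniform a ≈ ⟪ F ⟫ (a ∷ t)) ⇔ satSO 𝒜 ρ [] (uniformDistribution k F)
    uniformDistribution-correct {k} F = mk⇔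
      (λ p → from eqv λ { (a ∷ t) → from (∑-const≈1⇔uniform a) (sym (p t a)) })
      (λ p t a → sym (to (∑-const≈1⇔uniform a) (to eqv p (a ∷ t))))
      where
      s = ∑ₙ (app F (Vec.map suc (allFin (suc k))))
      eqv : satSO 𝒜 ρ [] (∀* (suc k) (s ≐ᴺ oneₙ)) ⇔ (∀ e → ∑ (const (⟪ F ⟫ e)) ≈ 1#)
      eqv = ∀*-correct ρ (s ≐ᴺ oneₙ) λ e → ≐ᴺ-correct ρ e s oneₙ
        (∑-cong {h = const (⟪ F ⟫ e)} λ b → trans
          (reflexive (≡.cong ⟪ F ⟫ (≡.sym (Vec.map-∘ (Vec.lookup (b ∷ e)) suc (allFin (suc k))))))
          (at-allFin ⟪ F ⟫ e))
        refl

    mixture-correct : ∀ {k} (g : k ∈ Γ) (κ : 0 ∈ Γ) (h : k ∈ Γ) (κ′ : 0 ∈ Γ) (f : k ∈ Γ)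
                      {𝕏 : Vec Universe k → ℝ} →
                      (∀ s → 𝕏 s ≈ ⟪ f ⟫ s) → ⟪ κ′ ⟫ [] ≈ 1# - ⟪ κ ⟫ [] →
                      (∀ s → (⟪ g ⟫ ⊔[ ⟪ κ ⟫ [] ] ⟪ h ⟫) s ≈ 𝕏 s) ⇔ satSO 𝒜 ρ [] (mixture k g κ h κ′ f)
    mixture-correct {k} g κ h κ′ f 𝕏≈f κ′≈1-κ = ⇔-sym (∀*-correct ρ (s ≐ᴺ t) λ e → ≐ᴺ-correct ρ e s t
      (+-cong (*-congˡ (at-allFin ⟪ g ⟫ e)) (*-cong κ′≈1-κ (at-allFin ⟪ h ⟫ e)))
      (trans (at-allFin ⟪ f ⟫ e) (sym (𝕏≈f e))))
      where
      s = (app κ [] ⊠ app g (allFin k)) ⊞ (app κ′ [] ⊠ app h (allFin k))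
      t = app f (allFin k)

    -- `F₀` and `F` agree only pointwise up to `≈`, as required for `∀′`: there the quantified
    -- function is known to be uniform only through its defining condition.
    reweighting-correct : ∀ D x (f : length D ∈ Γ) (F : suc (length D) ∈ Γ) (g : length (D ⊕ x) ∈ Γ) {𝕏 F₀} →
                          (∀ s → 𝕏 s ≈ ⟪ f ⟫ s) → (∀ t a → F₀ t a ≈ ⟪ F ⟫ (a ∷ t)) →
                          (∀ s → (D ⊢ 𝕏 [ F₀ // x ]) s ≈ ⟪ g ⟫ s) ⇔ satSO 𝒜 ρ [] (reweighting D x f F g)
    reweighting-correct D x f F g {𝕏} {F₀} 𝕏≈f F₀≈F =
      ⇔-sym (∀*-correct ρ (app g (allFin l) ≐ᴺ ∑* k weight) λ s → mk⇔ sym sym ⇔-∘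
        ≐ᴺ-correct ρ s (app g (allFin l)) (∑* k weight) (at-allFin ⟪ g ⟫ s)
          (trans (value-∑* (ρ after id) s k weight) (∑ᵛ-cong (weight-correct s))))
      where
      k = length D
      l = length (D ⊕ x)
      i = index (∈-⊕ D x)
      weight = (app f (inner k) ⊠ app F ((k ↑ʳ i) ∷ inner k)) given
               update D (inner k) (k ↑ʳ i) x ≐ outer k (allFin l)
      weight-correct : ∀ s t → value (ρ after id) (t ++ s) weight ≈
                               (𝕏 t * F₀ t (Vec.lookup s i)) when ((D ⊢ t [ Vec.lookup s i / x ]) ≟ᵛ s)
      weight-correct s t = when-≡
        (≡.trans (map-update (Vec.lookup (t ++ s)) D (inner k) (k ↑ʳ i) x)
          (≡.trans (≡.cong₂ (λ t a → update D t a x) (lookup-inner t s) (Vec.lookup-++ʳ t s i))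
                   (≡.sym (update-correct D t (Vec.lookup s i) x))))
        (≡.trans (lookup-outer t s (allFin l)) (Vec.map-lookup-allFin s))
        (*-cong (trans (at-inner ⟪ f ⟫ t s) (sym (𝕏≈f t)))
          (trans (reflexive (≡.cong₂ (λ a t → ⟪ F ⟫ (a ∷ t)) (Vec.lookup-++ʳ t s i) (lookup-inner t s)))
                 (sym (F₀≈F t (Vec.lookup s i)))))

  -- Excluded middle enters at negated atoms, conjunctions and both kinds of universal quantifier.
  dual-correct : ∀ {Γ n} (ρ : FunctionEnv 𝒜 Γ) (e : Vec Universe n) (φ : SO τ Γ n) →
                 (¬ satSO 𝒜 ρ e φ) ⇔ satSO 𝒜 ρ e (dual φ)
  dual-correct ρ e (x ≐ᶠ y)    = mk⇔ id id
  dual-correct ρ e (x ≠ᶠ y)    = mk⇔ (decidable-stable em) (λ p ¬p → ¬p p)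
  dual-correct ρ e (i ≐ⁿ j)    = mk⇔ id id
  dual-correct ρ e (i ≠ⁿ j)    = mk⇔ (decidable-stable em) (λ p ¬p → ¬p p)
  dual-correct ρ e (rel P xs)  = mk⇔ id id
  dual-correct ρ e (¬rel P xs) = mk⇔ (decidable-stable em) (λ p ¬p → ¬p p)
  dual-correct ρ e (φ ∧ ψ)     = mk⇔
    (λ ¬φψ → case em {satSO 𝒜 ρ e φ} of λ where
      (yes p) → inj₂ (to (dual-correct ρ e ψ) λ q → ¬φψ (p , q))
      (no ¬p) → inj₁ (to (dual-correct ρ e φ) ¬p))
    [ (λ d (p , _) → from (dual-correct ρ e φ) d p) , (λ d (_ , q) → from (dual-correct ρ e ψ) d q) ]′
  dual-correct ρ e (φ ∨ ψ)     = mk⇔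
    (λ ¬φψ → to (dual-correct ρ e φ) (¬φψ ∘ inj₁) , to (dual-correct ρ e ψ) (¬φψ ∘ inj₂))
    (λ (c , d) → [ from (dual-correct ρ e φ) c , from (dual-correct ρ e ψ) d ]′)
  dual-correct ρ e (∃¹ φ)      = mk⇔
    (λ ¬φ a → to (dual-correct ρ (a ∷ e) φ) λ p → ¬φ (a , p))
    (λ d (a , p) → from (dual-correct ρ (a ∷ e) φ) (d a) p)
  dual-correct ρ e (∀¹ φ)      = mk⇔
    (λ ¬φ → decidable-stable em λ ¬d → ¬φ λ a → decidable-stable em λ ¬p →
      ¬d (a , to (dual-correct ρ (a ∷ e) φ) ¬p))
    (λ (a , d) p → from (dual-correct ρ (a ∷ e) φ) d (p a))
  dual-correct ρ e (∃² k φ)    = mk⇔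
    (λ ¬φ f → to (dual-correct (f ∷ ρ) e φ) λ p → ¬φ (f , p))
    (λ d (f , p) → from (dual-correct (f ∷ ρ) e φ) (d f) p)
  dual-correct ρ e (∀² k φ)    = mk⇔
    (λ ¬φ → decidable-stable em λ ¬d → ¬φ λ f → decidable-stable em λ ¬p →
      ¬d (f , to (dual-correct (f ∷ ρ) e φ) ¬p))
    (λ (f , d) p → from (dual-correct (f ∷ ρ) e φ) d (p f))

  -- The weightings only have to agree up to ≈, since a quantified function
  -- determines a team no further than that.
  translate-correct : ∀ {Γ D} (φ : Formula τ D) (f : length D ∈ Γ) (ρ : FunctionEnv 𝒜 Γ) {𝕏 : Weighting 𝒜 D} →
                      (∀ s → 𝕏 s ≈ All.lookup ρ f s) →
                      sat 𝒜 D 𝕏 φ ⇔ satSO 𝒜 ρ [] (translate φ f)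
  translate-correct (x ≐ y)     f ρ 𝕏≈f = onSupport-correct ρ f _ 𝕏≈f λ s → mk⇔ id id
  translate-correct (x ≠ y)     f ρ 𝕏≈f = onSupport-correct ρ f _ 𝕏≈f λ s → mk⇔ id id
  translate-correct {D = D} (rel P xs)  f ρ 𝕏≈f = onSupport-correct ρ f _ 𝕏≈f λ s →
    mk⇔ (≡.subst ⟦ P ⟧ (lookup-variables {D} s xs)) (≡.subst ⟦ P ⟧ (≡.sym (lookup-variables {D} s xs)))
  translate-correct {D = D} (¬rel P xs) f ρ 𝕏≈f = onSupport-correct ρ f _ 𝕏≈f λ s →
    mk⇔ (λ ¬p → ¬p ∘ ≡.subst ⟦ P ⟧ (≡.sym (lookup-variables {D} s xs)))
        (λ ¬p → ¬p ∘ ≡.subst ⟦ P ⟧ (lookup-variables {D} s xs))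
  translate-correct {D = D} H[ xs ]≐H[ ys ] f ρ {𝕏} 𝕏≈f =
    ⇔-sym (≐ᴺ-correct ρ [] (negEntropy {D = D} f xs) (negEntropy {D = D} f ys) refl refl) ⇔-∘
    mk⇔ (λ eq → -‿injective (trans (H≈ xs) (trans eq (sym (H≈ ys)))))
        (λ eq → trans (sym (H≈ xs)) (trans (-‿cong eq) (H≈ ys)))
    where
    H≈ : ∀ {m} (xs : Vec (VarOf D) m) → - value (ρ after id) [] (negEntropy {D = D} f xs) ≈ entropy {D} 𝕏 xs
    H≈ = negEntropy-correct ρ {D} f 𝕏≈f
  translate-correct (φ ∧ ψ)     f ρ 𝕏≈f = translate-correct φ f ρ 𝕏≈f ×-⇔ translate-correct ψ f ρ 𝕏≈f
  translate-correct {Γ} {D} (φ ∨ ψ) f ρ {𝕏} 𝕏≈f = mk⇔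
    (λ (𝕐 , ℤ , k , 𝕐-team , ℤ-team , 0≤k , k≤1 , mix , p , q) →
      let ρ′ = const (1# - k) ∷ const k ∷ ℤ ∷ 𝕐 ∷ ρ in
      𝕐 , ℤ , const k , const (1# - k) ,
      to (team-correct ρ′ D g) 𝕐-team , to (team-correct ρ′ D h) ℤ-team ,
      from (≤ᴺ-correct ρ′ [] zeroₙ (app κ []) refl refl) 0≤k ,
      from (≤ᴺ-correct ρ′ [] (app κ []) oneₙ refl refl) k≤1 ,
      from (≐ᴺ-correct ρ′ [] (app κ [] ⊞ app κ′ []) oneₙ refl refl) (x+[y-x]≈y k 1#) ,
      to (mixture-correct ρ′ g κ h κ′ f′ {𝕏} 𝕏≈f refl) mix ,
      to (translate-correct φ g ρ′ λ _ → refl) p ,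
      to (translate-correct ψ h ρ′ λ _ → refl) q)
    (λ (𝕐 , ℤ , k , k′ , 𝕐-team , ℤ-team , 0≤k , k≤1 , k+k′≈1 , mix , p , q) →
      let ρ′ = k′ ∷ k ∷ ℤ ∷ 𝕐 ∷ ρ in
      𝕐 , ℤ , k [] ,
      from (team-correct ρ′ D g) 𝕐-team , from (team-correct ρ′ D h) ℤ-team ,
      to (≤ᴺ-correct ρ′ [] zeroₙ (app κ []) refl refl) 0≤k ,
      to (≤ᴺ-correct ρ′ [] (app κ []) oneₙ refl refl) k≤1 ,
      from (mixture-correct ρ′ g κ h κ′ f′ {𝕏} 𝕏≈f
        -- The conjunct κ + κ′ = 1 recovers the coefficient 1 - k of the second team.
        (x+y≈z⇒y≈z-x (to (≐ᴺ-correct ρ′ [] (app κ [] ⊞ app κ′ []) oneₙ refl refl) k+k′≈1))) mix ,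
      from (translate-correct φ g ρ′ λ _ → refl) p ,
      from (translate-correct ψ h ρ′ λ _ → refl) q)
    where
    Γ′ = 0 ∷ 0 ∷ length D ∷ length D ∷ Γ
    g h f′ : length D ∈ Γ′
    g  = there (there (there (here ≡.refl)))
    h  = there (there (here ≡.refl))
    f′ = there (there (there (there f)))
    κ κ′ : 0 ∈ Γ′
    κ  = there (here ≡.refl)
    κ′ = here ≡.refl
    x+y≈z⇒y≈z-x : ∀ {x y z} → x + y ≈ z → y ≈ z - x
    x+y≈z⇒y≈z-x {x} {y} x+y≈z = trans (sym (xyx⁻¹≈y x y)) (+-congʳ x+y≈z)
  translate-correct {D = D} (∃′ x φ) f ρ {𝕏} 𝕏≈f = mk⇔
    (λ (F , F-distribution , p) →
      let F′ = λ (as : Vec Universe (suc (length D))) → F (Vec.tail as) (Vec.head as)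
          g  = D ⊢ 𝕏 [ F // x ] in
      F′ , to (distribution-correct (F′ ∷ ρ) (here ≡.refl)) F-distribution , g ,
      to (reweighting-correct (g ∷ F′ ∷ ρ) D x _ _ (here ≡.refl) 𝕏≈f (λ _ _ → refl)) (λ _ → refl) ,
      to (translate-correct φ _ _ λ _ → refl) p)
    (λ (F , F-distribution , g , g-correct , p) →
      (λ t a → F (a ∷ t)) , from (distribution-correct (F ∷ ρ) (here ≡.refl)) F-distribution ,
      from (translate-correct φ _ (g ∷ F ∷ ρ)
        (from (reweighting-correct (g ∷ F ∷ ρ) D x _ _ _ 𝕏≈f (λ _ _ → refl)) g-correct)) p)
  translate-correct {D = D} (∀′ x φ) f ρ {𝕏} 𝕏≈f = mk⇔
    (λ p →
      let F = λ (as : Vec Universe (suc (length D))) → uniform (Vec.head as)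
          g = D ⊢ 𝕏 [ const uniform // x ] in
      F , to (uniformDistribution-correct (F ∷ ρ) (here ≡.refl)) (λ _ _ → refl) , g ,
      to (reweighting-correct (g ∷ F ∷ ρ) D x _ _ (here ≡.refl) 𝕏≈f (λ _ _ → refl)) (λ _ → refl) ,
      to (translate-correct φ _ _ λ _ → refl) p)
    (λ (F , F-uniform , g , g-correct , p) →
      from (translate-correct φ _ (g ∷ F ∷ ρ)
        (from (reweighting-correct (g ∷ F ∷ ρ) D x _ _ _ 𝕏≈f
          (from (uniformDistribution-correct (F ∷ ρ) (here ≡.refl)) F-uniform)) g-correct)) p)
  translate-correct (∼ φ)       f ρ 𝕏≈f =
    dual-correct ρ [] (translate φ f) ⇔-∘
    mk⇔ (λ ¬p → ¬p ∘ from (translate-correct φ f ρ 𝕏≈f)) (λ ¬q → ¬q ∘ to (translate-correct φ f ρ 𝕏≈f))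

mainTheorem9 : ExcludedMiddle 0ℓ → (R : RealNumbers) → let open Semantics R in
    ((τ : Vocabulary) (v̄ : Domain) → Unique v̄ → (φ : Formula τ v̄) → IsFO[H] φ →
    Σ[ ψ ∈ SO τ (length v̄ ∷ []) 0 ] IsESO ψ ×
    (∀ (𝒜 : Structure τ) (𝕏 : Weighting 𝒜 v̄) → IsTeam 𝒜 v̄ 𝕏 →
    (𝒜 ⊨[ 𝕏 ] φ) ⇔ (⟨ 𝒜 , functionOf 𝒜 v̄ 𝕏 ⟩⊨ ψ)))
    ×
    ((τ : Vocabulary) (v̄ : Domain) → Unique v̄ → (φ : Formula τ v̄) →
    Σ[ ψ ∈ SO τ (length v̄ ∷ []) 0 ]
    (∀ (𝒜 : Structure τ) (𝕏 : Weighting 𝒜 v̄) → IsTeam 𝒜 v̄ 𝕏 →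
    (𝒜 ⊨[ 𝕏 ] φ) ⇔ (⟨ 𝒜 , functionOf 𝒜 v̄ 𝕏 ⟩⊨ ψ)))
mainTheorem9 em R =
  (λ τ v̄ _ φ φ-FO[H] →
    translate φ (here ≡.refl) , translate-isESO φ (here ≡.refl) φ-FO[H] , λ 𝒜 𝕏 _ → correct 𝒜 𝕏 φ) ,
  (λ τ v̄ _ φ → translate φ (here ≡.refl) , λ 𝒜 𝕏 _ → correct 𝒜 𝕏 φ)
  where
  open RealNumbers R using (refl)
  open Semantics R
  correct : ∀ {τ v̄} (𝒜 : Structure τ) (𝕏 : Weighting 𝒜 v̄) (φ : Formula τ v̄) →
            (𝒜 ⊨[ 𝕏 ] φ) ⇔ (⟨ 𝒜 , functionOf 𝒜 v̄ 𝕏 ⟩⊨ translate φ (here ≡.refl))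
  correct 𝒜 𝕏 φ = Correctness.translate-correct em R 𝒜 φ (here ≡.refl) (𝕏 ∷ []) λ _ → refl
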